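{- Let $\mathcal{E}$ be a subset in $\mathbb{F}_q^2$ with $|\mathcal{E}|\gg q^{4/3}$. There exists a distinct distance subset $U\subseteq\mathcal{E}$ satisfying $$q^{1/3}\ll |U|\ll q^{1/2}.$$
   Context: $\mathbb{F}_q$ is the finite field of order $q$, where $q=p^r$ for some prime $p$ and positive integer $r$. The notation $X\ll Y$ (equivalently $Y\gg X$) means that there exists a constant $C>0$ such that $X\le CY$, where $X,Y$ are viewed as functions in $q$. For $\mathbf{x}=(x_1,x_2)\in\mathbb{F}_q^2$ write $||\mathbf{x}||=x_1^2+x_2^2\in\mathbb{F}_q$. A subset $U\subseteq\mathcal{E}$ is called a distinct distance subset if there are no four distinct points $\mathbf{x},\mathbf{y},\mathbf{z},\mathbf{t}\in U$ such that $||\mathbf{x}-\mathbf{y}||=||\mathbf{z}-\mathbf{t}||$.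
   Formalization: The characteristic p is assumed odd: for p = 2 one has ||x|| = (x_1+x_2)^2, and the claim fails for E = {x : x_1+x_2 in V} with V an F_2-subspace of size q^{1/3}, where every distinct distance subset has |U| ≪ q^{1/6}. -}

module Defs where

open import Algebra.Apartness.Bundles using (HeytingField; HeytingCommutativeRing)
open import Algebra.Bundles using (CommutativeRing)
open import Data.Fin.Base using (Fin)
open import Data.List.Base using (List; []; _∷_; length)
open import Data.Nat.Base using (ℕ; _≤_; _^_) renaming (_*_ to _·_)
open import Data.Product.Base using (_×_; _,_)
open import Data.Product.Relation.Binary.Pointwise.NonDependent using (×-setoid)
open import Function.Bundles using (Inverse)
open import Level using (Level; _⊔_)
open import Relation.Binary.Bundles using (Setoid)
open import Relation.Binary.PropositionalEquality.Properties as ≡ using ()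
open import Relation.Nullary.Negation using (¬_)
import Data.List.Membership.Setoid as Membership
import Data.List.Relation.Binary.Subset.Setoid as Subset
import Data.List.Relation.Unary.Unique.Setoid as Uniqueness

-- X ≪ Y with its implied constant made explicit, where one side is the real
-- number q^(a/b).  Both sides are nonnegative, so the inequality is raised to
-- the b-th power (b is always positive below).  A natural constant suffices:
-- enlarging the constant of a bound X ≤ C Y preserves the bound.

infix 4 _^[_/_]≪⟨_⟩_ _≪⟨_⟩_^[_/_]

-- q^(a/b) ≤ C n
_^[_/_]≪⟨_⟩_ : ℕ → ℕ → ℕ → ℕ → ℕ → Set
q ^[ a / b ]≪⟨ C ⟩ n = q ^ a ≤ (C · n) ^ b

-- n ≤ C q^(a/b)
_≪⟨_⟩_^[_/_] : ℕ → ℕ → ℕ → ℕ → ℕ → Set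
n ≪⟨ C ⟩ q ^[ a / b ] = n ^ b ≤ C ^ b · q ^ a

module _ {c ℓ₁ ℓ₂ : Level} (F : HeytingField c ℓ₁ ℓ₂) where

  open CommutativeRing
    (HeytingCommutativeRing.commutativeRing (HeytingField.heytingCommutativeRing F))

  -- For a finite F, _≈_ and invertibility are decidable, so the apartness of F
  -- is just _≉_ and F is a field in the classical sense.
  HasOrder : ℕ → Set (c ⊔ ℓ₁)
  HasOrder q = Inverse setoid (≡.setoid (Fin q))

  Point : Set c
  Point = Carrier × Carrier

  planeSetoid : Setoid c ℓ₁
  planeSetoid = ×-setoid setoid setoid

  infixl 6 _-ᵖ_
  _-ᵖ_ : Point → Point → Point
  (x₁ , x₂) -ᵖ (y₁ , y₂) = (x₁ - y₁ , x₂ - y₂)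

  -- In characteristic 2 this degenerates to (x₁ + x₂)².
  ‖_‖ : Point → Carrier
  ‖ x₁ , x₂ ‖ = x₁ * x₁ + x₂ * x₂

  open Uniqueness planeSetoid using (Unique)
  open Membership planeSetoid using (_∈_)

  -- A finite subset of the plane, given by a repetition-free enumeration, so
  -- that its cardinality is the length of the list.
  record PointSet : Set (c ⊔ ℓ₁) where
    field
      points : List Point
      unique : Unique points

  open PointSet

  -- Uniqueness of the four-element list says that x, y, z, t are pairwise distinct.
  DistinctDistance : PointSet → Set (c ⊔ ℓ₁)
  DistinctDistance U =
    ∀ {x y z t} → x ∈ points U → y ∈ points U → z ∈ points U → t ∈ points U →
    Unique (x ∷ y ∷ z ∷ t ∷ []) → ¬ (‖ x -ᵖ y ‖ ≈ ‖ z -ᵖ t ‖)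

module _ {c ℓ₁ ℓ₂ : Level} {F : HeytingField c ℓ₁ ℓ₂} where

  open Subset (planeSetoid F) using () renaming (_⊆_ to _⊆ˡ_)
  open PointSet

  ∣_∣ : PointSet F → ℕ
  ∣ E ∣ = length (points E)

  infix 4 _⊆_
  _⊆_ : PointSet F → PointSet F → Set (c ⊔ ℓ₁)
  U ⊆ E = points U ⊆ˡ points E

{-# OPTIONS --safe #-}
-- Let n = |E|, and let N be the number of (x, y, z, t) ∈ E⁴ with ‖x - y‖ = ‖z - t‖ ≠ 0.  If
-- q N ≪ n⁴, deleting points of E one by one, never increasing (bad quadruples) / |E|⁴ and
-- (pairs at distance 0) / |E|² combined, leaves about q^(1/3) points with so few bad
-- configurations that half of the points survive when these are deleted as well.  (There are
-- at most 2 q n pairs at distance 0.)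
--
-- For N, Cauchy–Schwarz gives N ≤ n T, where T counts the isosceles triangles: x lies on the
-- bisector of y and z.  A second moment bound for point-line incidences reduces T to the
-- bisector energy Q, the number of (y, z, y′, z′) ∈ E⁴ for which one reflection exchanges y
-- with z and y′ with z′.  Such a reflection maps (y, y′) to (z, z′), so that for each
-- direction Q is a correlation of the counts of pairs modulo translation in that direction.
-- Bounding their covariance by their variance gives q Q ≪ N + q² n² + n³, and together
-- q T ≪ n³ as soon as q⁴ ≪ n³.
module Submission where

open import Defs
open import Algebra.Apartness.Bundles using (HeytingField; HeytingCommutativeRing)
open import Algebra.Bundles using (CommutativeRing; RawRing)
open import Algebra.Core using (Op₁; Op₂)
open import Algebra.Morphism.Structures using (IsRingMonomorphism)
open import Algebra.Solver.Ring.AlmostCommutativeRing using (fromCommutativeRing; _-Raw-AlmostCommutative⟶_)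
open import Algebra.Structures using (IsCommutativeRing)
open import Data.Bool.Base using (true; false)
open import Data.Fin.Base using (Fin)
open import Data.Fin.Permutation using (Permutation; permutation)
open import Data.Integer.Base as ℤ using (ℤ)
open import Data.List.Base using (List; []; _∷_; _++_; length; map; filter; allFin; cartesianProduct; cartesianProductWith)
open import Data.List.Membership.Propositional using (_∈_)
open import Data.List.Membership.Propositional.Properties
  using (∈-allFin; ∈-filter⁻; ∈-cartesianProduct⁺; ∈-cartesianProductWith⁺; ∈-cartesianProductWith⁻)
open import Data.List.Properties using (length-map; length-tabulate)
open import Data.List.Relation.Unary.All as All using (All; []; _∷_)
open import Data.List.Relation.Unary.AllPairs using ([]; _∷_)
open import Data.List.Relation.Unary.Any using (here; there)
open import Data.List.Relation.Unary.Unique.DecPropositional using (unique?)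
open import Data.List.Relation.Unary.Unique.Propositional using (Unique)
open import Data.Maybe.Base using (Maybe; just; nothing)
open import Data.Nat.Base as ℕ
  using (ℕ; zero; suc; _+_; _*_; _^_; _≤_; _<_; z≤n; s≤s; NonZero; >-nonZero; >-nonZero⁻¹)
open import Data.Nat.Divisibility using (m%n≡0⇒n∣m)
open import Data.Nat.DivMod using (_/_; _%_; m≡m%n+[m/n]*n; m%n<n)
open import Data.Nat.Primality using (Prime; prime⇒irreducible)
open import Data.Nat.Properties hiding (_≟_)
open import Data.Nat.Tactic.RingSolver using (solve-∀)
open import Data.Product.Base using (∃-syntax; _×_; _,_; proj₁; proj₂)
open import Data.Sum.Base using (_⊎_; inj₁; inj₂; [_,_]′)
open import Function.Base using (_∘_; id; it)
open import Function.Bundles using (Inverse)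
open import Level using (Level; 0ℓ)
open import Relation.Binary.Bundles using (Setoid)
open import Relation.Binary.Definitions using (DecidableEquality)
open import Relation.Binary.PropositionalEquality
  using (_≡_; _≢_; refl; sym; trans; cong; cong₂; subst; subst₂; module ≡-Reasoning)
open import Relation.Nullary.Decidable using (Dec; yes; no; _because_; _×-dec_; ¬?)
open import Relation.Nullary.Negation using (¬_; contradiction)
import Algebra.Morphism.RingMonomorphism
import Algebra.Properties.AbelianGroup
import Algebra.Properties.CommutativeMonoid.Sum
import Algebra.Properties.CommutativeSemigroup
import Algebra.Properties.Group
import Algebra.Properties.Monoid.Mult
import Algebra.Properties.Ring
import Algebra.Properties.Semiring.Mult
import Algebra.Solver.Ring
import Data.Fin.Properties as Fin
import Data.Integer.Properties as ℤ
import Data.List.Membership.Setoid.Properties as Membership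
import Data.List.Relation.Unary.Unique.Propositional.Properties as Unique
import Data.List.Relation.Unary.Unique.Setoid.Properties as UniqueSetoid
import Data.Product.Properties as Product
import Data.Sign.Base as Sign
import Relation.Binary.PropositionalEquality.Properties as ≡

-- The estimates form a circle: N is bounded through T, T through the incidences, these through Q,
-- and the bound for Q contains N again, because reflections preserve distances. The circle closes
-- because N returns with a coefficient that the hypothesis makes small enough to be absorbed by
-- half of the left side. The exponent 4/3 is what the term q² n² in the bound for q Q demands:
-- multiplied by q² it has to be ≪ n⁵, that is, q⁴ ≪ n³. The exponent 1/3 comes from the sampling:
-- about k⁴ N / n⁴ ≪ k⁴ / q bad quadruples survive among k points, a small fraction of k when k³ ≪
-- q. Pairs at distance 0 require k q ≪ n, which for such k is the hypothesis on n once more.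

private variable
  A B X : Set
  P Q : Set

-- Finite sums of natural numbers

∑ : List A → (A → ℕ) → ℕ
∑ []       f = 0
∑ (x ∷ xs) f = f x + ∑ xs f

∑-cong-∈ : ∀ (xs : List A) {f g : A → ℕ} → (∀ {x} → x ∈ xs → f x ≡ g x) → ∑ xs f ≡ ∑ xs g
∑-cong-∈ []       eq = refl
∑-cong-∈ (x ∷ xs) eq = cong₂ _+_ (eq (here refl)) (∑-cong-∈ xs (eq ∘ there))

∑-cong : ∀ (xs : List A) {f g : A → ℕ} → (∀ x → f x ≡ g x) → ∑ xs f ≡ ∑ xs g
∑-cong xs eq = ∑-cong-∈ xs (λ {x} _ → eq x)

∑-mono-∈ : ∀ (xs : List A) {f g : A → ℕ} → (∀ {x} → x ∈ xs → f x ≤ g x) → ∑ xs f ≤ ∑ xs g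
∑-mono-∈ []       le = z≤n
∑-mono-∈ (x ∷ xs) le = +-mono-≤ (le (here refl)) (∑-mono-∈ xs (le ∘ there))

∑-mono : ∀ (xs : List A) {f g : A → ℕ} → (∀ x → f x ≤ g x) → ∑ xs f ≤ ∑ xs g
∑-mono xs le = ∑-mono-∈ xs (λ {x} _ → le x)

∑-+ : ∀ (xs : List A) (f g : A → ℕ) → ∑ xs (λ x → f x + g x) ≡ ∑ xs f + ∑ xs g
∑-+ []       f g = refl
∑-+ (x ∷ xs) f g = trans (cong (f x + g x +_) (∑-+ xs f g)) (interchange (f x) (g x) _ _)
  where
  interchange : ∀ a b c d → a + b + (c + d) ≡ a + c + (b + d)
  interchange = solve-∀

∑-*ˡ : ∀ (xs : List A) c (f : A → ℕ) → ∑ xs (λ x → c * f x) ≡ c * ∑ xs f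
∑-*ˡ []       c f = sym (*-zeroʳ c)
∑-*ˡ (x ∷ xs) c f = trans (cong (c * f x +_) (∑-*ˡ xs c f)) (sym (*-distribˡ-+ c (f x) _))

∑-*ʳ : ∀ (xs : List A) c (f : A → ℕ) → ∑ xs (λ x → f x * c) ≡ ∑ xs f * c
∑-*ʳ xs c f = trans (∑-cong xs (λ x → *-comm (f x) c)) (trans (∑-*ˡ xs c f) (*-comm c _))

∑-const : ∀ (xs : List A) c → ∑ xs (λ _ → c) ≡ length xs * c
∑-const []       c = refl
∑-const (x ∷ xs) c = cong (c +_) (∑-const xs c)

∑-≤ : ∀ (xs : List A) {f : A → ℕ} {c} → (∀ x → f x ≤ c) → ∑ xs f ≤ length xs * c
∑-≤ xs {c = c} le = ≤-trans (∑-mono xs le) (≤-reflexive (∑-const xs c))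

∑-0 : ∀ (xs : List A) → ∑ xs (λ _ → 0) ≡ 0
∑-0 xs = trans (∑-const xs 0) (*-zeroʳ (length xs))

∑-swap : ∀ (xs : List A) (ys : List B) (f : A → B → ℕ) →
         ∑ xs (λ x → ∑ ys (f x)) ≡ ∑ ys (λ y → ∑ xs (λ x → f x y))
∑-swap []       ys f = sym (∑-0 ys)
∑-swap (x ∷ xs) ys f = trans (cong (∑ ys (f x) +_) (∑-swap xs ys f)) (sym (∑-+ ys (f x) _))

∑-*-∑ : ∀ (xs : List A) (ys : List B) (f : A → ℕ) (g : B → ℕ) →
        ∑ xs f * ∑ ys g ≡ ∑ xs (λ x → ∑ ys (λ y → f x * g y))
∑-*-∑ xs ys f g =
  trans (sym (∑-*ʳ xs _ f)) (∑-cong xs (λ x → sym (∑-*ˡ ys (f x) g)))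

∑-<-average : ∀ (xs : List A) (f : A → ℕ) {c} → ∑ xs f < length xs * c → ∃[ x ] x ∈ xs × f x < c
∑-<-average (x ∷ xs) f {c} lt with <-≤-connex (f x) c
... | inj₁ fx<c = x , here refl , fx<c
... | inj₂ c≤fx =
  let y , y∈ , fy<c = ∑-<-average xs f (+-cancelˡ-< c _ _ (≤-<-trans (+-monoˡ-≤ _ c≤fx) lt))
  in  y , there y∈ , fy<c

∑-cartesianProductWith : ∀ (_∙_ : A → B → X) xs ys (f : X → ℕ) →
  ∑ (cartesianProductWith _∙_ xs ys) f ≡ ∑ xs (λ x → ∑ ys (λ y → f (x ∙ y)))
∑-cartesianProductWith _∙_ []       ys f = refl
∑-cartesianProductWith _∙_ (x ∷ xs) ys f =
  trans (∑-++ (map (x ∙_) ys)) (cong₂ _+_ (∑-map ys) (∑-cartesianProductWith _∙_ xs ys f))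
  where
  ∑-++ : ∀ zs {zs′} → ∑ (zs ++ zs′) f ≡ ∑ zs f + ∑ zs′ f
  ∑-++ []       = refl
  ∑-++ (z ∷ zs) = trans (cong (f z +_) (∑-++ zs)) (sym (+-assoc (f z) _ _))
  ∑-map : ∀ zs → ∑ (map (x ∙_) zs) f ≡ ∑ zs (λ z → f (x ∙ z))
  ∑-map []       = refl
  ∑-map (z ∷ zs) = cong (f (x ∙ z) +_) (∑-map zs)

-- Quadratic inequalities without subtraction

2ab≤a²+b² : ∀ a b → 2 * (a * b) ≤ a * a + b * b
2ab≤a²+b² a b with ≤-total a b
... | inj₁ a≤b = let d , b≡ = m≤n⇒∃[o]m+o≡n a≤b in subst (λ b → 2 * (a * b) ≤ a * a + b * b) b≡
  (≤-trans (m≤m+n _ (d * d)) (≤-reflexive (expand a d)))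
  where
  expand : ∀ a d → 2 * (a * (a + d)) + d * d ≡ a * a + (a + d) * (a + d)
  expand = solve-∀
... | inj₂ b≤a = let d , a≡ = m≤n⇒∃[o]m+o≡n b≤a in subst (λ a → 2 * (a * b) ≤ a * a + b * b) a≡
  (≤-trans (m≤m+n _ (d * d)) (≤-reflexive (expand b d)))
  where
  expand : ∀ b d → 2 * ((b + d) * b) + d * d ≡ (b + d) * (b + d) + b * b
  expand = solve-∀

module _ (g h : A → ℕ) where

  private
    -- The sum over x of 2 u v ≤ u² + v² for u = `a + h x` and v = `b + g x`. When a = g x₀ and b =
    -- h x₀, the difference u - v is (g - h)(x₀) - (g - h)(x), so this bounds the cross terms
    -- between x₀ and the other elements in the square of ∑ (g - h).
    cross : ∀ (xs : List A) a b → let l = length xs in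
      2 * (l * (a * b) + a * ∑ xs g + b * ∑ xs h + ∑ xs (λ x → g x * h x)) ≤
      l * (a * a) + 2 * (a * ∑ xs h) + ∑ xs (λ x → h x * h x)
        + (l * (b * b) + 2 * (b * ∑ xs g) + ∑ xs (λ x → g x * g x))
    cross []       a b = ≤-reflexive (nil a b)
      where
      nil : ∀ a b → 2 * (0 * (a * b) + a * 0 + b * 0 + 0) ≡
                    0 * (a * a) + 2 * (a * 0) + 0 + (0 * (b * b) + 2 * (b * 0) + 0)
      nil = solve-∀
    cross (x ∷ xs) a b = subst₂ _≤_
      (left a b (g x) (h x) (length xs) (∑ xs g) (∑ xs h) (∑ xs (λ x → g x * h x)))
      (right a b (g x) (h x) (length xs) (∑ xs g) (∑ xs h)
             (∑ xs (λ x → g x * g x)) (∑ xs (λ x → h x * h x)))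
      (+-mono-≤ (2ab≤a²+b² (a + h x) (b + g x)) (cross xs a b))
      where
      left : ∀ a b u v l U V W →
        2 * ((a + v) * (b + u)) + 2 * (l * (a * b) + a * U + b * V + W) ≡
        2 * ((1 + l) * (a * b) + a * (u + U) + b * (v + V) + (u * v + W))
      left = solve-∀
      right : ∀ a b u v l U V S T →
        (a + v) * (a + v) + (b + u) * (b + u) +
          (l * (a * a) + 2 * (a * V) + T + (l * (b * b) + 2 * (b * U) + S)) ≡
        (1 + l) * (a * a) + 2 * (a * (v + V)) + (v * v + T) +
          ((1 + l) * (b * b) + 2 * (b * (u + U)) + (u * u + S))
      right = solve-∀

  -- The Cauchy–Schwarz inequality (∑ (g - h))² ≤ l ∑ (g - h)², with both sides
  -- expanded and moved so that no subtraction occurs.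
  cauchy-schwarz-difference : ∀ (xs : List A) → let l = length xs; G = ∑ xs g; H = ∑ xs h in
    2 * (l * ∑ xs (λ x → g x * h x)) + (G * G + H * H) ≤
    2 * (G * H) + l * (∑ xs (λ x → g x * g x) + ∑ xs (λ x → h x * h x))
  cauchy-schwarz-difference []       = z≤n
  cauchy-schwarz-difference (x ∷ xs) = subst₂ _≤_
    (left (g x) (h x) (length xs) (∑ xs g) (∑ xs h) (∑ xs (λ x → g x * h x)))
    (right (g x) (h x) (length xs) (∑ xs g) (∑ xs h)
           (∑ xs (λ x → g x * g x)) (∑ xs (λ x → h x * h x)))
    -- The terms of x with itself: the same amount completes the new products and squares on both
    -- sides.
    (+-monoˡ-≤ (2 * (g x * h x) + (g x * g x + h x * h x))
      (+-mono-≤ (cauchy-schwarz-difference xs) (cross xs (g x) (h x))))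
    where
    left : ∀ u v l U V W →
      2 * (l * W) + (U * U + V * V) + 2 * (l * (u * v) + u * U + v * V + W)
        + (2 * (u * v) + (u * u + v * v)) ≡
      2 * ((1 + l) * (u * v + W)) + ((u + U) * (u + U) + (v + V) * (v + V))
    left = solve-∀
    right : ∀ u v l U V S T →
      2 * (U * V) + l * (S + T)
        + (l * (u * u) + 2 * (u * V) + T + (l * (v * v) + 2 * (v * U) + S))
        + (2 * (u * v) + (u * u + v * v)) ≡
      2 * ((u + U) * (v + V)) + (1 + l) * (u * u + S + (v * v + T))
    right = solve-∀

-- The sum of 2 (a w) (b i - d) ≤ (a w)² + (b i - d)², with the negative terms moved across.
∑-amgm : ∀ (xs : List A) (w i : A → ℕ) a b d →
  2 * (a * b * ∑ xs (λ x → w x * i x)) + 2 * (d * b * ∑ xs i) ≤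
  a * a * ∑ xs (λ x → w x * w x) + 2 * (a * d * ∑ xs w) + length xs * (d * d)
    + b * b * ∑ xs (λ x → i x * i x)
∑-amgm []       w i a b d = ≤-trans (≤-reflexive (nil a b d)) z≤n
  where
  nil : ∀ a b d → 2 * (a * b * 0) + 2 * (d * b * 0) ≡ 0
  nil = solve-∀
∑-amgm (x ∷ xs) w i a b d = subst₂ _≤_
  (left a b d (w x) (i x) (∑ xs (λ x → w x * i x)) (∑ xs i))
  (right a b d (w x) (i x) (length xs) (∑ xs (λ x → w x * w x)) (∑ xs w) (∑ xs (λ x → i x * i x)))
  (+-mono-≤ (2ab≤a²+b² (a * w x + d) (b * i x)) (∑-amgm xs w i a b d))
  where
  left : ∀ a b d u v W I →
    2 * ((a * u + d) * (b * v)) + (2 * (a * b * W) + 2 * (d * b * I)) ≡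
    2 * (a * b * (u * v + W)) + 2 * (d * b * (v + I))
  left = solve-∀
  right : ∀ a b d u v l S U T →
    (a * u + d) * (a * u + d) + b * v * (b * v)
      + (a * a * S + 2 * (a * d * U) + l * (d * d) + b * b * T) ≡
    a * a * (u * u + S) + 2 * (a * d * (u + U)) + (1 + l) * (d * d) + b * b * (v * v + T)
  right = solve-∀

-- Indicators and counting

⟦_⟧ : Dec P → ℕ
⟦ true  because _ ⟧ = 1
⟦ false because _ ⟧ = 0

⟦⟧-mono : (P → Q) → (p? : Dec P) (q? : Dec Q) → ⟦ p? ⟧ ≤ ⟦ q? ⟧
⟦⟧-mono f (no  _) _       = z≤n
⟦⟧-mono f (yes p) (yes _) = ≤-refl
⟦⟧-mono f (yes p) (no ¬q) = contradiction (f p) ¬q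

⟦⟧-true : P → (p? : Dec P) → ⟦ p? ⟧ ≡ 1
⟦⟧-true p (yes _) = refl
⟦⟧-true p (no ¬p) = contradiction p ¬p

⟦⟧-false : ¬ P → (p? : Dec P) → ⟦ p? ⟧ ≡ 0
⟦⟧-false ¬p (yes p) = contradiction p ¬p
⟦⟧-false ¬p (no  _) = refl

⟦⟧≤1 : (p? : Dec P) → ⟦ p? ⟧ ≤ 1
⟦⟧≤1 (yes _) = ≤-refl
⟦⟧≤1 (no  _) = z≤n

⟦⟧-× : (p? : Dec P) (q? : Dec Q) → ⟦ p? ×-dec q? ⟧ ≡ ⟦ p? ⟧ * ⟦ q? ⟧
⟦⟧-× (yes _) (yes _) = refl
⟦⟧-× (yes _) (no  _) = refl
⟦⟧-× (no  _) _       = refl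

module _ {R : A → Set} (R? : ∀ x → Dec (R x)) where

  count-0 : ∀ (xs : List A) → (∀ {x} → x ∈ xs → ¬ R x) → ∑ xs (λ x → ⟦ R? x ⟧) ≡ 0
  count-0 xs none = trans (∑-cong-∈ xs (λ {x} x∈ → ⟦⟧-false (none x∈) (R? x))) (∑-0 xs)

  count-≤1 : ∀ {xs : List A} → Unique xs →
             (∀ {x y} → x ∈ xs → y ∈ xs → R x → R y → x ≡ y) → ∑ xs (λ x → ⟦ R? x ⟧) ≤ 1
  count-≤1 {[]}     _            _   = z≤n
  count-≤1 {x ∷ xs} (x∉xs ∷ uxs) amo with R? x
  ... | no  _  = count-≤1 uxs (λ y∈ z∈ → amo (there y∈) (there z∈))
  ... | yes rx = s≤s (≤-reflexive (count-0 xs λ y∈ ry →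
                   All.lookup x∉xs y∈ (amo (here refl) (there y∈) rx ry)))

  count-≤2 : ∀ {xs : List A} → Unique xs →
             (∀ {x} → R x → ∃[ y ] ∀ {z} → R z → z ≡ x ⊎ z ≡ y) → ∑ xs (λ x → ⟦ R? x ⟧) ≤ 2
  count-≤2 {[]}     _            _   = z≤n
  count-≤2 {x ∷ xs} (x∉xs ∷ uxs) amt with R? x
  ... | no  _  = count-≤2 uxs amt
  ... | yes rx = s≤s (count-≤1 uxs λ z∈ t∈ rz rt → trans (other z∈ rz) (sym (other t∈ rt)))
    where
    other : ∀ {z} → z ∈ xs → R z → z ≡ proj₁ (amt rx)
    other z∈ rz = [ (λ z≡x → contradiction (sym z≡x) (All.lookup x∉xs z∈)) , (λ z≡y → z≡y) ]′
                    (proj₂ (amt rx) rz)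

∑-δ : ∀ (_≟_ : DecidableEquality A) {xs : List A} → Unique xs → ∀ {a} → a ∈ xs →
      ∑ xs (λ x → ⟦ a ≟ x ⟧) ≡ 1
∑-δ _≟_ {x ∷ xs} (x∉xs ∷ _) {a} (here a≡x) =
  cong₂ _+_ (⟦⟧-true a≡x (a ≟ x))
            (count-0 (a ≟_) xs λ y∈ a≡y → All.lookup x∉xs y∈ (trans (sym a≡x) a≡y))
∑-δ _≟_ {x ∷ xs} (x∉xs ∷ uxs) {a} (there a∈) =
  cong₂ _+_ (⟦⟧-false (λ a≡x → All.lookup x∉xs a∈ (sym a≡x)) (a ≟ x)) (∑-δ _≟_ uxs a∈)

-- Finite types and weighted fibres

record Finite (A : Set) : Set where
  infix 4 _≟_
  field
    _≟_      : DecidableEquality A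
    elements : List A
    unique   : Unique elements
    complete : ∀ a → a ∈ elements

  order : ℕ
  order = length elements

  ∑-⟦≟⟧ : ∀ a → ∑ elements (λ x → ⟦ a ≟ x ⟧) ≡ 1
  ∑-⟦≟⟧ a = ∑-δ _≟_ unique (complete a)

  ∑-⟦≟⟧² : ∀ a b → ∑ elements (λ x → ⟦ a ≟ x ⟧ * ⟦ b ≟ x ⟧) ≡ ⟦ a ≟ b ⟧
  ∑-⟦≟⟧² a b with a ≟ b
  ... | yes refl = trans (∑-cong elements (λ x → idem (a ≟ x))) (∑-⟦≟⟧ a)
    where
    idem : (p? : Dec P) → ⟦ p? ⟧ * ⟦ p? ⟧ ≡ ⟦ p? ⟧
    idem (yes _) = refl
    idem (no  _) = refl
  ... | no a≢b = trans (∑-cong elements disjoint) (∑-0 elements)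
    where
    disjoint : ∀ x → ⟦ a ≟ x ⟧ * ⟦ b ≟ x ⟧ ≡ 0
    disjoint x with a ≟ x | b ≟ x
    ... | yes a≡x | yes b≡x = contradiction (trans a≡x (sym b≡x)) a≢b
    ... | yes _   | no  _   = refl
    ... | no  _   | _       = refl

  fibre : List X → (X → ℕ) → (X → A) → A → ℕ
  fibre xs f φ a = ∑ xs (λ x → f x * ⟦ φ x ≟ a ⟧)

  ∑-fibre : ∀ (xs : List X) f φ → ∑ elements (fibre xs f φ) ≡ ∑ xs f
  ∑-fibre xs f φ = trans (∑-swap elements xs _) (∑-cong xs λ x →
    trans (∑-*ˡ elements (f x) _) (trans (cong (f x *_) (∑-⟦≟⟧ (φ x))) (*-identityʳ (f x))))

  -- Double counting: the inner product of two fibre counts counts the pairs with a common image.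
  -- All second moments of the energy bound are turned into configuration counts, and back, in this
  -- way.
  ∑-fibre² : ∀ {Y : Set} (xs : List X) (ys : List Y) f g φ ψ →
    ∑ elements (λ a → fibre xs f φ a * fibre ys g ψ a) ≡
    ∑ xs (λ x → ∑ ys (λ y → f x * g y * ⟦ φ x ≟ ψ y ⟧))
  ∑-fibre² xs ys f g φ ψ = begin
    ∑ elements (λ a → fibre xs f φ a * fibre ys g ψ a)
      ≡⟨ ∑-cong elements (λ a → ∑-*-∑ xs ys _ _) ⟩
    ∑ elements (λ a → ∑ xs (λ x → ∑ ys (λ y → f x * ⟦ φ x ≟ a ⟧ * (g y * ⟦ ψ y ≟ a ⟧))))
      ≡⟨ ∑-swap elements xs _ ⟩
    ∑ xs (λ x → ∑ elements (λ a → ∑ ys (λ y → f x * ⟦ φ x ≟ a ⟧ * (g y * ⟦ ψ y ≟ a ⟧))))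
      ≡⟨ ∑-cong xs (λ x → ∑-swap elements ys _) ⟩
    ∑ xs (λ x → ∑ ys (λ y → ∑ elements (λ a → f x * ⟦ φ x ≟ a ⟧ * (g y * ⟦ ψ y ≟ a ⟧))))
      ≡⟨ ∑-cong xs (λ x → ∑-cong ys (λ y → collapse x y)) ⟩
    ∑ xs (λ x → ∑ ys (λ y → f x * g y * ⟦ φ x ≟ ψ y ⟧)) ∎
    where
    open ≡-Reasoning
    rearrange : ∀ a b c d → a * b * (c * d) ≡ a * c * (b * d)
    rearrange = solve-∀
    collapse : ∀ x y → ∑ elements (λ a → f x * ⟦ φ x ≟ a ⟧ * (g y * ⟦ ψ y ≟ a ⟧)) ≡
                       f x * g y * ⟦ φ x ≟ ψ y ⟧
    collapse x y = trans
      (∑-cong elements (λ a → rearrange (f x) ⟦ φ x ≟ a ⟧ (g y) ⟦ ψ y ≟ a ⟧))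
      (trans (∑-*ˡ elements (f x * g y) _) (cong (f x * g y *_) (∑-⟦≟⟧² (φ x) (ψ y))))

-- Covariance of fibre counts

module _ (𝔹 : Finite A) (𝕂 : Finite B) (xs : List X) (κ : X → B) where

  private
    module 𝔹 = Finite 𝔹
    module 𝕂 = Finite 𝕂

  coincidences : (X → A) → (X → A) → ℕ
  coincidences φ ψ = ∑ xs (λ x → ∑ xs (λ y → ⟦ φ x 𝔹.≟ ψ y ⟧))

  coincidencesᵏ : (X → A) → (X → A) → ℕ
  coincidencesᵏ φ ψ = ∑ xs (λ x → ∑ xs (λ y → ⟦ φ x 𝔹.≟ ψ y ⟧ * ⟦ κ x 𝕂.≟ κ y ⟧))

  private
    fibreᵏ : (X → A) → A → B → ℕ
    fibreᵏ φ a = 𝕂.fibre xs (λ x → ⟦ φ x 𝔹.≟ a ⟧) κ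

    ∑-fibreᵏ : ∀ φ a → ∑ 𝕂.elements (fibreᵏ φ a) ≡ ∑ xs (λ x → ⟦ φ x 𝔹.≟ a ⟧)
    ∑-fibreᵏ φ a = 𝕂.∑-fibre xs _ κ

    ∑∑-fibreᵏ : ∀ φ ψ →
      ∑ 𝔹.elements (λ a → ∑ 𝕂.elements (fibreᵏ φ a) * ∑ 𝕂.elements (fibreᵏ ψ a)) ≡
      coincidences φ ψ
    ∑∑-fibreᵏ φ ψ = begin
      ∑ 𝔹.elements (λ a → ∑ 𝕂.elements (fibreᵏ φ a) * ∑ 𝕂.elements (fibreᵏ ψ a))
        ≡⟨ ∑-cong 𝔹.elements (λ a → cong₂ _*_ (widen φ a) (widen ψ a)) ⟩
      ∑ 𝔹.elements (λ a → 𝔹.fibre xs (λ _ → 1) φ a * 𝔹.fibre xs (λ _ → 1) ψ a)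
        ≡⟨ 𝔹.∑-fibre² xs xs (λ _ → 1) (λ _ → 1) φ ψ ⟩
      ∑ xs (λ x → ∑ xs (λ y → 1 * 1 * ⟦ φ x 𝔹.≟ ψ y ⟧))
        ≡⟨ ∑-cong xs (λ x → ∑-cong xs (λ y → *-identityˡ _)) ⟩
      coincidences φ ψ ∎
      where
      open ≡-Reasoning
      widen : ∀ φ a → ∑ 𝕂.elements (fibreᵏ φ a) ≡ 𝔹.fibre xs (λ _ → 1) φ a
      widen φ a = trans (∑-fibreᵏ φ a) (∑-cong xs (λ x → sym (*-identityˡ _)))

    ∑∑-fibreᵏ² : ∀ φ ψ →
      ∑ 𝔹.elements (λ a → ∑ 𝕂.elements (λ k → fibreᵏ φ a k * fibreᵏ ψ a k)) ≡
      coincidencesᵏ φ ψ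
    ∑∑-fibreᵏ² φ ψ = begin
      ∑ 𝔹.elements (λ a → ∑ 𝕂.elements (λ k → fibreᵏ φ a k * fibreᵏ ψ a k))
        ≡⟨ ∑-cong 𝔹.elements (λ a → 𝕂.∑-fibre² xs xs (λ x → ⟦ φ x 𝔹.≟ a ⟧) (λ y → ⟦ ψ y 𝔹.≟ a ⟧) κ κ) ⟩
      ∑ 𝔹.elements (λ a → ∑ xs (λ x → ∑ xs (λ y →
        ⟦ φ x 𝔹.≟ a ⟧ * ⟦ ψ y 𝔹.≟ a ⟧ * ⟦ κ x 𝕂.≟ κ y ⟧)))
        ≡⟨ ∑-swap 𝔹.elements xs _ ⟩
      ∑ xs (λ x → ∑ 𝔹.elements (λ a → ∑ xs (λ y →
        ⟦ φ x 𝔹.≟ a ⟧ * ⟦ ψ y 𝔹.≟ a ⟧ * ⟦ κ x 𝕂.≟ κ y ⟧)))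
        ≡⟨ ∑-cong xs (λ x → ∑-swap 𝔹.elements xs _) ⟩
      ∑ xs (λ x → ∑ xs (λ y → ∑ 𝔹.elements (λ a →
        ⟦ φ x 𝔹.≟ a ⟧ * ⟦ ψ y 𝔹.≟ a ⟧ * ⟦ κ x 𝕂.≟ κ y ⟧)))
        ≡⟨ ∑-cong xs (λ x → ∑-cong xs (λ y → trans
             (∑-*ʳ 𝔹.elements _ _) (cong (_* ⟦ κ x 𝕂.≟ κ y ⟧) (𝔹.∑-⟦≟⟧² (φ x) (ψ y))))) ⟩
      coincidencesᵏ φ ψ ∎
      where open ≡-Reasoning

  -- Covariance is at most the mean of the two variances. For each a, let g and h count the fibres
  -- of φ and ψ over a, split by the value of κ; then (∑ g - ∑ h)² ≤ |𝕂| ∑ (g - h)² by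
  -- Cauchy-Schwarz, and the sum over a is the claim.
  coincidences-variance : ∀ φ ψ →
    2 * (𝕂.order * coincidencesᵏ φ ψ) + (coincidences φ φ + coincidences ψ ψ) ≤
    2 * coincidences φ ψ + 𝕂.order * (coincidencesᵏ φ φ + coincidencesᵏ ψ ψ)
  coincidences-variance φ ψ = subst₂ _≤_ left right
    (∑-mono 𝔹.elements (λ a → cauchy-schwarz-difference (fibreᵏ φ a) (fibreᵏ ψ a) 𝕂.elements))
    where
    open ≡-Reasoning
    G H GG HH GH : A → ℕ
    G a = ∑ 𝕂.elements (fibreᵏ φ a)
    H a = ∑ 𝕂.elements (fibreᵏ ψ a)
    GG a = ∑ 𝕂.elements (λ k → fibreᵏ φ a k * fibreᵏ φ a k)
    HH a = ∑ 𝕂.elements (λ k → fibreᵏ ψ a k * fibreᵏ ψ a k)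
    GH a = ∑ 𝕂.elements (λ k → fibreᵏ φ a k * fibreᵏ ψ a k)
    left : ∑ 𝔹.elements (λ a → 2 * (𝕂.order * GH a) + (G a * G a + H a * H a)) ≡
           2 * (𝕂.order * coincidencesᵏ φ ψ) + (coincidences φ φ + coincidences ψ ψ)
    left = begin
      ∑ 𝔹.elements (λ a → 2 * (𝕂.order * GH a) + (G a * G a + H a * H a))
        ≡⟨ ∑-+ 𝔹.elements _ _ ⟩
      ∑ 𝔹.elements (λ a → 2 * (𝕂.order * GH a)) + ∑ 𝔹.elements (λ a → G a * G a + H a * H a)
        ≡⟨ cong₂ _+_
             (trans (∑-*ˡ 𝔹.elements 2 _)
               (cong (2 *_) (trans (∑-*ˡ 𝔹.elements 𝕂.order _) (cong (𝕂.order *_) (∑∑-fibreᵏ² φ ψ)))))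
             (trans (∑-+ 𝔹.elements _ _) (cong₂ _+_ (∑∑-fibreᵏ φ φ) (∑∑-fibreᵏ ψ ψ))) ⟩
      2 * (𝕂.order * coincidencesᵏ φ ψ) + (coincidences φ φ + coincidences ψ ψ) ∎
    right : ∑ 𝔹.elements (λ a → 2 * (G a * H a) + 𝕂.order * (GG a + HH a)) ≡
            2 * coincidences φ ψ + 𝕂.order * (coincidencesᵏ φ φ + coincidencesᵏ ψ ψ)
    right = begin
      ∑ 𝔹.elements (λ a → 2 * (G a * H a) + 𝕂.order * (GG a + HH a))
        ≡⟨ ∑-+ 𝔹.elements _ _ ⟩
      ∑ 𝔹.elements (λ a → 2 * (G a * H a)) + ∑ 𝔹.elements (λ a → 𝕂.order * (GG a + HH a))
        ≡⟨ cong₂ _+_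
             (trans (∑-*ˡ 𝔹.elements 2 _) (cong (2 *_) (∑∑-fibreᵏ φ ψ)))
             (trans (∑-*ˡ 𝔹.elements 𝕂.order _) (cong (𝕂.order *_)
               (trans (∑-+ 𝔹.elements _ _) (cong₂ _+_ (∑∑-fibreᵏ² φ φ) (∑∑-fibreᵏ² ψ ψ))))) ⟩
      2 * coincidences φ ψ + 𝕂.order * (coincidencesᵏ φ φ + coincidencesᵏ ψ ψ) ∎

-- Sparse subsets by repeated deletion

tuples : ℕ → List A → List (List A)
tuples zero    xs = [] ∷ []
tuples (suc k) xs = cartesianProductWith _∷_ xs (tuples k xs)

∈-tuples⁻ : ∀ k (xs : List A) {v} → v ∈ tuples k xs → length v ≡ k × All (_∈ xs) v
∈-tuples⁻ zero    xs (here refl) = refl , []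
∈-tuples⁻ (suc k) xs v∈ with ∈-cartesianProductWith⁻ _∷_ xs (tuples k xs) v∈
... | _ , _ , a∈ , w∈ , refl =
  let length≡k , w⊆ = ∈-tuples⁻ k xs w∈ in cong suc length≡k , a∈ ∷ w⊆

∑-filter : ∀ {R : A → Set} (R? : ∀ x → Dec (R x)) (xs : List A) (f : A → ℕ) →
           ∑ (filter R? xs) f ≡ ∑ xs (λ x → ⟦ R? x ⟧ * f x)
∑-filter R? []       f = refl
∑-filter R? (x ∷ xs) f with R? x
... | yes _ = cong₂ _+_ (sym (+-identityʳ (f x))) (∑-filter R? xs f)
... | no  _ = ∑-filter R? xs f

module Sparsification (_≟_ : DecidableEquality A) where

  remove : A → List A → List A
  remove x = filter (λ a → ¬? (a ≟ x))

  avoids : List A → A → ℕ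
  avoids []      x = 1
  avoids (a ∷ v) x = ⟦ ¬? (a ≟ x) ⟧ * avoids v x

  length-remove : ∀ {xs x} → Unique xs → x ∈ xs → suc (length (remove x xs)) ≡ length xs
  length-remove {xs} {x} uxs x∈ = begin
    1 + length (remove x xs)
      ≡⟨ cong₂ _+_ (∑-δ _≟_ uxs x∈) (trans (sym (∑-filter _ xs _))
           (trans (∑-const (remove x xs) 1) (*-identityʳ _))) ⟨
    ∑ xs (λ a → ⟦ x ≟ a ⟧) + ∑ xs (λ a → ⟦ ¬? (a ≟ x) ⟧ * 1)
      ≡⟨ ∑-+ xs _ _ ⟨
    ∑ xs (λ a → ⟦ x ≟ a ⟧ + ⟦ ¬? (a ≟ x) ⟧ * 1)
      ≡⟨ ∑-cong xs split ⟩
    ∑ xs (λ _ → 1)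
      ≡⟨ trans (∑-const xs 1) (*-identityʳ _) ⟩
    length xs ∎
    where
    open ≡-Reasoning
    split : ∀ a → ⟦ x ≟ a ⟧ + ⟦ ¬? (a ≟ x) ⟧ * 1 ≡ 1
    split a with x ≟ a | a ≟ x
    ... | yes _   | yes _   = refl
    ... | no  _   | no  _   = refl
    ... | yes x≡a | no  a≢x = contradiction (sym x≡a) a≢x
    ... | no  x≢a | yes a≡x = contradiction (sym a≡x) x≢a

  remove-⊆ : ∀ x xs {a} → a ∈ remove x xs → a ∈ xs
  remove-⊆ x xs = proj₁ ∘ ∈-filter⁻ _

  remove-unique : ∀ x {xs} → Unique xs → Unique (remove x xs)
  remove-unique x = Unique.filter⁺ _

  ∑-tuples-remove : ∀ k x xs f →
    ∑ (tuples k (remove x xs)) f ≡ ∑ (tuples k xs) (λ v → avoids v x * f v)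
  ∑-tuples-remove zero    x xs f = cong (_+ 0) (sym (+-identityʳ (f [])))
  ∑-tuples-remove (suc k) x xs f = begin
    ∑ (tuples (suc k) (remove x xs)) f
      ≡⟨ ∑-cartesianProductWith _∷_ (remove x xs) _ f ⟩
    ∑ (remove x xs) (λ a → ∑ (tuples k (remove x xs)) (λ v → f (a ∷ v)))
      ≡⟨ ∑-filter _ xs _ ⟩
    ∑ xs (λ a → ⟦ ¬? (a ≟ x) ⟧ * ∑ (tuples k (remove x xs)) (λ v → f (a ∷ v)))
      ≡⟨ ∑-cong xs (λ a → trans
           (cong (⟦ ¬? (a ≟ x) ⟧ *_) (∑-tuples-remove k x xs (λ v → f (a ∷ v))))
           (trans (sym (∑-*ˡ (tuples k xs) ⟦ ¬? (a ≟ x) ⟧ _))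
                  (∑-cong (tuples k xs) (λ v → sym (*-assoc ⟦ ¬? (a ≟ x) ⟧ _ _))))) ⟩
    ∑ xs (λ a → ∑ (tuples k xs) (λ v → avoids (a ∷ v) x * f (a ∷ v)))
      ≡⟨ ∑-cartesianProductWith _∷_ xs _ _ ⟨
    ∑ (tuples (suc k) xs) (λ v → avoids v x * f v) ∎
    where open ≡-Reasoning

  avoids-or-hits : ∀ {v} → Unique v → ∀ x → avoids v x + ∑ v (λ a → ⟦ a ≟ x ⟧) ≤ 1
  avoids-or-hits {[]}    _          x = ≤-refl
  avoids-or-hits {a ∷ v} (a∉v ∷ uv) x with a ≟ x
  ... | no  _    = subst (λ n → n + ∑ v (λ b → ⟦ b ≟ x ⟧) ≤ 1) (sym (+-identityʳ (avoids v x))) (avoids-or-hits uv x)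
  ... | yes refl = s≤s (≤-reflexive (count-0 (_≟ a) v
                     λ b∈ b≡a → All.lookup a∉v b∈ (sym b≡a)))

  ∑-avoids : ∀ {xs v} → Unique xs → Unique v → All (_∈ xs) v →
             ∑ xs (avoids v) + length v ≤ length xs
  ∑-avoids {xs} {v} uxs uv v⊆ = begin
    ∑ xs (avoids v) + length v
      ≡⟨ cong (∑ xs (avoids v) +_) hits ⟨
    ∑ xs (avoids v) + ∑ xs (λ x → ∑ v (λ a → ⟦ a ≟ x ⟧))
      ≡⟨ ∑-+ xs _ _ ⟨
    ∑ xs (λ x → avoids v x + ∑ v (λ a → ⟦ a ≟ x ⟧))
      ≤⟨ ∑-≤ xs (avoids-or-hits uv) ⟩
    length xs * 1
      ≡⟨ *-identityʳ _ ⟩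
    length xs ∎
    where
    open ≤-Reasoning
    hits : ∑ xs (λ x → ∑ v (λ a → ⟦ a ≟ x ⟧)) ≡ length v
    hits = trans (∑-swap xs v _) (trans
      (∑-cong-∈ v (λ a∈ → ∑-δ _≟_ uxs (All.lookup v⊆ a∈)))
      (trans (∑-const v 1) (*-identityʳ _)))

  -- Double counting of the pairs (x, v) with x not in v: a tuple on which f is nonzero has k
  -- distinct entries, so it is destroyed by the deletion of exactly those k elements.
  removal-average : ∀ k {xs} (f : List A → ℕ) → (∀ {v} → f v ≢ 0 → Unique v) → Unique xs →
    ∑ xs (λ x → ∑ (tuples k (remove x xs)) f) + k * ∑ (tuples k xs) f ≤
    length xs * ∑ (tuples k xs) f
  removal-average k {xs} f supp uxs = begin
    ∑ xs (λ x → ∑ (tuples k (remove x xs)) f) + k * ∑ (tuples k xs) f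
      ≡⟨ cong₂ _+_
           (trans (∑-cong xs (λ x → ∑-tuples-remove k x xs f)) (∑-swap xs (tuples k xs) _))
           (sym (∑-*ˡ (tuples k xs) k f)) ⟩
    ∑ (tuples k xs) (λ v → ∑ xs (λ x → avoids v x * f v)) + ∑ (tuples k xs) (λ v → k * f v)
      ≡⟨ ∑-+ (tuples k xs) _ _ ⟨
    ∑ (tuples k xs) (λ v → ∑ xs (λ x → avoids v x * f v) + k * f v)
      ≤⟨ ∑-mono-∈ (tuples k xs) pointwise ⟩
    ∑ (tuples k xs) (λ v → length xs * f v)
      ≡⟨ ∑-*ˡ (tuples k xs) (length xs) f ⟩
    length xs * ∑ (tuples k xs) f ∎
    where
    open ≤-Reasoning
    pointwise : ∀ {v} → v ∈ tuples k xs →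
                ∑ xs (λ x → avoids v x * f v) + k * f v ≤ length xs * f v
    pointwise {v} v∈ with f v | supp {v}
    ... | zero  | _    = ≤-reflexive (trans
                           (cong₂ _+_ (trans (∑-*ʳ xs 0 _) (*-zeroʳ (∑ xs (avoids v)))) (*-zeroʳ k))
                           (sym (*-zeroʳ (length xs))))
    ... | suc c | uniq = let length≡k , v⊆ = ∈-tuples⁻ k xs v∈ in begin
      ∑ xs (λ x → avoids v x * suc c) + k * suc c
        ≡⟨ cong₂ (λ a b → a + b * suc c) (∑-*ʳ xs (suc c) _) (sym length≡k) ⟩
      ∑ xs (avoids v) * suc c + length v * suc c
        ≡⟨ *-distribʳ-+ (suc c) (∑ xs (avoids v)) _ ⟨
      (∑ xs (avoids v) + length v) * suc c
        ≤⟨ *-monoˡ-≤ (suc c) (∑-avoids uxs (uniq λ ()) v⊆) ⟩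
      length xs * suc c ∎

  -- M behaves on average like the number of k-element edges spanned by a vertex set.
  Decays : ℕ → (List A → ℕ) → Set
  Decays k M = ∀ {xs} → Unique xs →
    ∑ xs (λ x → M (remove x xs)) + k * M xs ≤ length xs * M xs

  module _ {M₄ M₂ : List A → ℕ} (decays₄ : Decays 4 M₄) (decays₂ : Decays 2 M₂) where

    private
      -- Scaled so that potential xs / |xs|⁴ does not increase, on average, when a
      -- random element is removed: M₄ drops by the factor 1 - 4/|xs| and M₂ by
      -- the factor 1 - 2/|xs|.
      potential : ℕ → List A → ℕ
      potential X xs = X * M₄ xs + length xs * length xs * M₂ xs

      -- Rests on (l - 4) l³ ≤ (l - 1)⁴ and (l - 2) l ≤ (l - 1)². In terms of j = l - 1 the slack is
      -- 6 j² + 8 j + 3 in the first and 1 in the second; `e₃` and `e₅` exhibit it.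
      potential-average : ∀ X l j {S₄ S₂ m₄ m₂} → l ≡ 1 + j →
        S₄ + 4 * m₄ ≤ l * m₄ → S₂ + 2 * m₂ ≤ l * m₂ →
        (X * S₄ + j * j * S₂) * l ^ 4 ≤ l * ((X * m₄ + l * l * m₂) * j ^ 4)
      potential-average X l j {S₄} {S₂} {m₄} {m₂} l≡1+j le₄ le₂ = subst₂ _≤_
        (e₁ X l j S₄ S₂) (e₂ X l j m₄ m₂)
        (*-monoʳ-≤ l (+-mono-≤
          (*-monoʳ-≤ X (subst (λ l → S₄ * (l * l * l) ≤ j * j * j * j * m₄) (sym l≡1+j) bound₄))
          (*-monoʳ-≤ (j * j * (l * l)) (subst (λ l → S₂ * l ≤ j * j * m₂) (sym l≡1+j) bound₂))))
        where
        e₁ : ∀ X l j S₄ S₂ →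
          l * (X * (S₄ * (l * l * l)) + j * j * (l * l) * (S₂ * l)) ≡
          (X * S₄ + j * j * S₂) * (l * (l * (l * (l * 1))))
        e₁ = solve-∀
        e₂ : ∀ X l j m₄ m₂ →
          l * (X * (j * j * j * j * m₄) + j * j * (l * l) * (j * j * m₂)) ≡
          l * ((X * m₄ + l * l * m₂) * (j * (j * (j * (j * 1)))))
        e₂ = solve-∀
        e₃ : ∀ j S m → (S + 4 * m) * ((1 + j) * (1 + j) * (1 + j)) ≡
          S * ((1 + j) * (1 + j) * (1 + j)) + (6 * (j * j) + 8 * j + 3) * m
            + (4 * (j * j * j) + 6 * (j * j) + 4 * j + 1) * m
        e₃ = solve-∀
        e₄ : ∀ j m → (1 + j) * m * ((1 + j) * (1 + j) * (1 + j)) ≡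
          j * j * j * j * m + (4 * (j * j * j) + 6 * (j * j) + 4 * j + 1) * m
        e₄ = solve-∀
        e₅ : ∀ j S m → (S + 2 * m) * (1 + j) ≡ S * (1 + j) + m + (2 * j + 1) * m
        e₅ = solve-∀
        e₆ : ∀ j m → (1 + j) * m * (1 + j) ≡ j * j * m + (2 * j + 1) * m
        e₆ = solve-∀
        bound₄ : S₄ * ((1 + j) * (1 + j) * (1 + j)) ≤ j * j * j * j * m₄
        bound₄ = ≤-trans (m≤m+n _ _)
          (+-cancelʳ-≤ ((4 * (j * j * j) + 6 * (j * j) + 4 * j + 1) * m₄) _ _
            (subst₂ _≤_ (e₃ j S₄ m₄) (e₄ j m₄) (*-monoˡ-≤ ((1 + j) * (1 + j) * (1 + j))
              (subst (λ l → S₄ + 4 * m₄ ≤ l * m₄) l≡1+j le₄))))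
        bound₂ : S₂ * (1 + j) ≤ j * j * m₂
        bound₂ = ≤-trans (m≤m+n _ _) (+-cancelʳ-≤ ((2 * j + 1) * m₂) _ _
          (subst₂ _≤_ (e₅ j S₂ m₂) (e₆ j m₂) (*-monoˡ-≤ (1 + j)
            (subst (λ l → S₂ + 2 * m₂ ≤ l * m₂) l≡1+j le₂))))

    potential-removal : ∀ X {xs j} → Unique xs → length xs ≡ suc j → ∃[ x ] x ∈ xs ×
      potential X (remove x xs) * length xs ^ 4 ≤ potential X xs * j ^ 4
    potential-removal X {xs} {j} uxs length≡ =
      let x , x∈ , lt = ∑-<-average xs _ total in x , x∈ , ≤-pred lt
      where
      l = length xs
      S₄ = ∑ xs (λ x → M₄ (remove x xs))
      S₂ = ∑ xs (λ x → M₂ (remove x xs))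
      shape : ∀ {x} → x ∈ xs → potential X (remove x xs) * l ^ 4 ≡
              (X * M₄ (remove x xs) + j * j * M₂ (remove x xs)) * l ^ 4
      shape {x} x∈ = cong (λ i → (X * M₄ (remove x xs) + i * i * M₂ (remove x xs)) * l ^ 4)
        (suc-injective (trans (length-remove uxs x∈) length≡))
      -- The averaging lemma is strict; the `suc` converts its conclusion into the required ≤.
      total : ∑ xs (λ x → potential X (remove x xs) * l ^ 4) < l * suc (potential X xs * j ^ 4)
      total = begin-strict
        ∑ xs (λ x → potential X (remove x xs) * l ^ 4)
          ≡⟨ ∑-cong-∈ xs shape ⟩
        ∑ xs (λ x → (X * M₄ (remove x xs) + j * j * M₂ (remove x xs)) * l ^ 4)
          ≡⟨ trans (∑-*ʳ xs (l ^ 4) _) (cong (_* l ^ 4)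
               (trans (∑-+ xs _ _) (cong₂ _+_ (∑-*ˡ xs X _) (∑-*ˡ xs (j * j) _)))) ⟩
        (X * S₄ + j * j * S₂) * l ^ 4
          ≤⟨ potential-average X l j length≡ (decays₄ uxs)
                                             (decays₂ uxs) ⟩
        l * (potential X xs * j ^ 4)
          <⟨ *-monoʳ-< l {{subst NonZero (sym length≡) _}} (n<1+n _) ⟩
        l * suc (potential X xs * j ^ 4) ∎
        where open ≤-Reasoning

    -- Iterates `potential-removal`; the factors j⁴ for the intermediate sizes j telescope, and they
    -- can be cancelled because no size falls below k, which is positive.
    sample : ∀ X k .{{_ : NonZero k}} d {xs} → Unique xs → length xs ≡ d + k →
      ∃[ ys ] (∀ {x} → x ∈ ys → x ∈ xs) × Unique ys × length ys ≡ k ×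
              potential X ys * length xs ^ 4 ≤ potential X xs * k ^ 4
    sample X k zero    {xs} uxs length≡ =
      xs , id , uxs , length≡ , ≤-reflexive (cong (λ l → potential X xs * l ^ 4) length≡)
    sample X k (suc d) {xs} uxs length≡ =
      let x , x∈ , le₁ = potential-removal X uxs length≡
          length-remove′ = suc-injective (trans (length-remove uxs x∈) length≡)
          ys , ys⊆ , uys , length-ys , le₂ = sample X k d (remove-unique x uxs) length-remove′
      in
      ys , remove-⊆ x xs ∘ ys⊆ , uys , length-ys ,
      *-cancelʳ-≤ _ _ (j ^ 4) {{m^n≢0 j 4 {{>-nonZero (≤-trans (>-nonZero⁻¹ k) (m≤n+m k d))}}}} (begin
        potential X ys * length xs ^ 4 * j ^ 4
          ≡⟨ swap-last (potential X ys) (length xs ^ 4) (j ^ 4) ⟩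
        potential X ys * j ^ 4 * length xs ^ 4
          ≤⟨ *-monoˡ-≤ (length xs ^ 4) (subst
               (λ l → potential X ys * l ^ 4 ≤ potential X (remove x xs) * k ^ 4)
               length-remove′ le₂) ⟩
        potential X (remove x xs) * k ^ 4 * length xs ^ 4
          ≡⟨ swap-last (potential X (remove x xs)) (k ^ 4) (length xs ^ 4) ⟩
        potential X (remove x xs) * length xs ^ 4 * k ^ 4
          ≤⟨ *-monoˡ-≤ (k ^ 4) le₁ ⟩
        potential X xs * j ^ 4 * k ^ 4
          ≡⟨ swap-last (potential X xs) (j ^ 4) (k ^ 4) ⟩
        potential X xs * k ^ 4 * j ^ 4 ∎)
      where
      open ≤-Reasoning
      j = d + k
      swap-last : ∀ a b c → a * b * c ≡ a * c * b
      swap-last = solve-∀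

    private
      Cleared : ℕ → List A → Set
      Cleared d xs = ∃[ ys ] (∀ {x} → x ∈ ys → x ∈ xs) × Unique ys ×
                     length xs ≤ length ys + d × length ys ≤ length xs × M₄ ys + M₂ ys ≡ 0

      decays : ∀ {xs} → Unique xs → 0 < M₄ xs + M₂ xs →
        ∑ xs (λ x → M₄ (remove x xs) + M₂ (remove x xs)) < length xs * (M₄ xs + M₂ xs)
      decays {xs} uxs 0<M = begin
        suc (∑ xs (λ x → M₄ (remove x xs) + M₂ (remove x xs)))
          ≡⟨ trans (cong suc (∑-+ xs _ _)) (+-comm 1 (S₄ + S₂)) ⟩
        S₄ + S₂ + 1
          ≤⟨ +-monoʳ-≤ (S₄ + S₂) (≤-trans 0<M (m≤m+n (M₄ xs + M₂ xs) (3 * M₄ xs + M₂ xs))) ⟩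
        S₄ + S₂ + (M₄ xs + M₂ xs + (3 * M₄ xs + M₂ xs))
          ≡⟨ regroup S₄ S₂ (M₄ xs) (M₂ xs) ⟩
        S₄ + 4 * M₄ xs + (S₂ + 2 * M₂ xs)
          ≤⟨ +-mono-≤ (decays₄ uxs) (decays₂ uxs) ⟩
        length xs * M₄ xs + length xs * M₂ xs
          ≡⟨ *-distribˡ-+ (length xs) (M₄ xs) (M₂ xs) ⟨
        length xs * (M₄ xs + M₂ xs) ∎
        where
        open ≤-Reasoning
        S₄ = ∑ xs (λ x → M₄ (remove x xs))
        S₂ = ∑ xs (λ x → M₂ (remove x xs))
        regroup : ∀ S₄ S₂ m₄ m₂ → S₄ + S₂ + (m₄ + m₂ + (3 * m₄ + m₂)) ≡ S₄ + 4 * m₄ + (S₂ + 2 * m₂)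
        regroup = solve-∀

    -- By `decays`, some deletion lowers `M₄ + M₂` as long as it is positive, so an upper bound d
    -- for it also bounds the number of deletions.
    clear : ∀ d {xs} → Unique xs → M₄ xs + M₂ xs ≤ d → Cleared d xs
    clear zero    {xs} uxs le = xs , id , uxs , m≤m+n _ 0 , ≤-refl , n≤0⇒n≡0 le
    clear (suc d) {xs} uxs le = [ below , equal ]′ (m≤n⇒m<n∨m≡n le)
      where
      below : M₄ xs + M₂ xs < suc d → Cleared (suc d) xs
      below lt =
        let ys , ys⊆ , uys , big , rest = clear d uxs (≤-pred lt)
        in  ys , ys⊆ , uys , ≤-trans big (+-monoʳ-≤ (length ys) (n≤1+n d)) , rest
      equal : M₄ xs + M₂ xs ≡ suc d → Cleared (suc d) xs
      equal M≡1+d =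
        let x , x∈ , lt = ∑-<-average xs (λ x → M₄ (remove x xs) + M₂ (remove x xs))
                            (decays uxs (subst (0 <_) (sym M≡1+d) (s≤s z≤n)))
            ys , ys⊆ , uys , big , small , M≡0 =
              clear d (remove-unique x uxs) (≤-pred (≤-trans lt le))
            1+length = length-remove uxs x∈
        in
        ys , remove-⊆ x xs ∘ ys⊆ , uys ,
        subst₂ _≤_ 1+length (sym (+-suc (length ys) d)) (s≤s big) ,
        ≤-trans small (≤-trans (n≤1+n _) (≤-reflexive 1+length)) , M≡0

    -- The alteration method, with successive deletion in place of a random sample. Taking X = k²
    -- gives the potential k² (M₄ + M₂) at size k; each of the last two hypotheses then contributes
    -- at most k / 4 to M₄ + M₂, so clearing the k sampled points deletes at most half of them.
    independent-subset : ∀ k .{{_ : NonZero k}} {xs} → Unique xs → k ≤ length xs →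
      4 * (k * k * k * M₄ xs) ≤ length xs ^ 4 → 4 * (k * M₂ xs) ≤ length xs * length xs →
      ∃[ ys ] (∀ {x} → x ∈ ys → x ∈ xs) × Unique ys ×
              k ≤ 2 * length ys × length ys ≤ k × M₄ ys + M₂ ys ≡ 0
    independent-subset k {xs} uxs k≤n le₄ le₂ =
      let d , k+d≡n = m≤n⇒∃[o]m+o≡n k≤n
          ys , ys⊆ , uys , length-ys , le = sample (k * k) k d uxs (trans (sym k+d≡n) (+-comm k d))
          zs , zs⊆ , uzs , big , small , M≡0 = clear (M₄ ys + M₂ ys) uys ≤-refl
      in
      zs , ys⊆ ∘ zs⊆ , uzs ,
      half {length zs} {M₄ ys + M₂ ys} (subst (_≤ length zs + (M₄ ys + M₂ ys)) length-ys big)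
           (few {M₄ ys} {M₂ ys} (subst (λ l → (k * k * M₄ ys + l * l * M₂ ys) * n ^ 4 ≤ potential (k * k) xs * k ^ 4)
                       length-ys le)) ,
      subst (length zs ≤_) length-ys small , M≡0
      where
      n = length xs
      open ≤-Reasoning
      instance
        n≢0 : NonZero n
        n≢0 = >-nonZero (≤-trans (>-nonZero⁻¹ k) k≤n)
      e₁ : ∀ k m₄ m₂ n → k * k * (n * (n * (n * (n * 1)))) * 2 * (2 * (m₄ + m₂)) ≡
                          4 * ((k * k * m₄ + k * k * m₂) * (n * (n * (n * (n * 1)))))
      e₁ = solve-∀
      e₂ : ∀ k m₄ m₂ n → 4 * ((k * k * m₄ + n * n * m₂) * (k * (k * (k * (k * 1))))) ≡
                          k * k * k * (4 * (k * k * k * m₄)) + k * k * k * (n * n) * (4 * (k * m₂))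
      e₂ = solve-∀
      e₃ : ∀ k n → k * k * k * (n * (n * (n * (n * 1)))) + k * k * k * (n * n) * (n * n) ≡
                   k * k * (n * (n * (n * (n * 1)))) * 2 * k
      e₃ = solve-∀
      few : ∀ {m₄ m₂} → (k * k * m₄ + k * k * m₂) * n ^ 4 ≤ potential (k * k) xs * k ^ 4 →
            2 * (m₄ + m₂) ≤ k
      few {m₄} {m₂} le = *-cancelˡ-≤ (k * k * n ^ 4 * 2)
        {{m*n≢0 (k * k * n ^ 4) 2 {{m*n≢0 (k * k) (n ^ 4) {{m*n≢0 k k}} {{m^n≢0 n 4}}}}}} (begin
        k * k * n ^ 4 * 2 * (2 * (m₄ + m₂))        ≡⟨ e₁ k m₄ m₂ n ⟩
        4 * ((k * k * m₄ + k * k * m₂) * n ^ 4)    ≤⟨ *-monoʳ-≤ 4 le ⟩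
        4 * (potential (k * k) xs * k ^ 4)         ≡⟨ e₂ k (M₄ xs) (M₂ xs) n ⟩
        k * k * k * (4 * (k * k * k * M₄ xs)) + k * k * k * (n * n) * (4 * (k * M₂ xs))
          ≤⟨ +-mono-≤ (*-monoʳ-≤ (k * k * k) le₄) (*-monoʳ-≤ (k * k * k * (n * n)) le₂) ⟩
        k * k * k * n ^ 4 + k * k * k * (n * n) * (n * n) ≡⟨ e₃ k n ⟩
        k * k * n ^ 4 * 2 * k ∎)
      e₄ : ∀ m → 2 * m ≡ m + m
      e₄ = solve-∀
      half : ∀ {l m} → k ≤ l + m → 2 * m ≤ k → k ≤ 2 * l
      half {l} {m} big few = +-cancelʳ-≤ k _ _ (begin
        k + k             ≡⟨ e₄ k ⟨
        2 * k             ≤⟨ *-monoʳ-≤ 2 big ⟩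
        2 * (l + m)       ≡⟨ *-distribˡ-+ 2 l m ⟩
        2 * l + 2 * m     ≤⟨ +-monoʳ-≤ (2 * l) few ⟩
        2 * l + k         ∎)

-- The geometry of a plane over a finite field

-- The ring solver with integer coefficients, which unlike coefficients in R
-- itself lets it recognise that terms cancel.
module IntegerCoefficients {c ℓ} (R : CommutativeRing c ℓ) where
  private
    open import Data.Integer.Base using (+_; -[1+_]; _⊖_)
    module R = CommutativeRing R
    open R using (_≈_; 0#; 1#) renaming (_+_ to _⊕_; _*_ to _⊗_; -_ to ⊝_)
    open Algebra.Properties.Semiring.Mult R.semiring using (×-homo-+; ×1-homo-*) renaming (_×_ to _·_)
    open Algebra.Properties.Ring R.ring using (-‿distribˡ-*; -‿distribʳ-*; -0#≈0#; -‿involutive)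
    open Algebra.Properties.AbelianGroup R.+-abelianGroup using (⁻¹-∙-comm)
    open Algebra.Properties.CommutativeSemigroup R.+-commutativeSemigroup using (interchange)
    open import Relation.Binary.Reasoning.Setoid R.setoid

    ⟦_⟧ᶻ : ℤ → R.Carrier
    ⟦ + n      ⟧ᶻ = n · 1#
    ⟦ -[1+ n ] ⟧ᶻ = ⊝ (suc n · 1#)

    ⟦⊖⟧ : ∀ m n → ⟦ m ⊖ n ⟧ᶻ ≈ m · 1# ⊕ ⊝ (n · 1#)
    ⟦⊖⟧ m       zero    = R.sym (R.trans (R.+-congˡ -0#≈0#) (R.+-identityʳ _))
    ⟦⊖⟧ zero    (suc n) = R.sym (R.+-identityˡ _)
    ⟦⊖⟧ (suc m) (suc n) = begin
      ⟦ suc m ⊖ suc n ⟧ᶻ                    ≡⟨ cong ⟦_⟧ᶻ (ℤ.[1+m]⊖[1+n]≡m⊖n m n) ⟩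
      ⟦ m ⊖ n ⟧ᶻ                            ≈⟨ ⟦⊖⟧ m n ⟩
      m · 1# ⊕ ⊝ (n · 1#)                   ≈⟨ R.+-identityˡ _ ⟨
      0# ⊕ (m · 1# ⊕ ⊝ (n · 1#))            ≈⟨ R.+-congʳ (R.-‿inverseʳ 1#) ⟨
      1# ⊕ ⊝ 1# ⊕ (m · 1# ⊕ ⊝ (n · 1#))     ≈⟨ interchange 1# (⊝ 1#) (m · 1#) (⊝ (n · 1#)) ⟩
      1# ⊕ m · 1# ⊕ (⊝ 1# ⊕ ⊝ (n · 1#))     ≈⟨ R.+-congˡ (⁻¹-∙-comm 1# (n · 1#)) ⟩
      suc m · 1# ⊕ ⊝ (suc n · 1#)           ∎

    ⟦+⟧ : ∀ i j → ⟦ i ℤ.+ j ⟧ᶻ ≈ ⟦ i ⟧ᶻ ⊕ ⟦ j ⟧ᶻ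
    ⟦+⟧ (+ m)      (+ n)      = ×-homo-+ 1# m n
    ⟦+⟧ (+ m)      -[1+ n ]   = ⟦⊖⟧ m (suc n)
    ⟦+⟧ -[1+ m ]   (+ n)      = R.trans (⟦⊖⟧ n (suc m)) (R.+-comm _ _)
    ⟦+⟧ -[1+ m ]   -[1+ n ]   = begin
      ⊝ (suc (suc (m ℕ.+ n)) · 1#)        ≡⟨ cong (λ k → ⊝ (suc k · 1#)) (ℤ+-suc m n) ⟨
      ⊝ ((suc m ℕ.+ suc n) · 1#)          ≈⟨ R.-‿cong (×-homo-+ 1# (suc m) (suc n)) ⟩
      ⊝ (suc m · 1# ⊕ suc n · 1#)         ≈⟨ ⁻¹-∙-comm _ _ ⟨
      ⊝ (suc m · 1#) ⊕ ⊝ (suc n · 1#)     ∎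
      where open import Data.Nat.Properties using () renaming (+-suc to ℤ+-suc)

    ⟦-◃⟧ : ∀ n → ⟦ Sign.- ℤ.◃ n ⟧ᶻ ≈ ⊝ (n · 1#)
    ⟦-◃⟧ zero    = R.sym -0#≈0#
    ⟦-◃⟧ (suc n) = R.refl

    ⟦+◃⟧ : ∀ n → ⟦ Sign.+ ℤ.◃ n ⟧ᶻ ≈ n · 1#
    ⟦+◃⟧ n = R.reflexive (cong ⟦_⟧ᶻ (ℤ.+◃n≡+n n))

    ⟦*⟧ : ∀ i j → ⟦ i ℤ.* j ⟧ᶻ ≈ ⟦ i ⟧ᶻ ⊗ ⟦ j ⟧ᶻ
    ⟦*⟧ (+ m)      (+ n)      = R.trans (⟦+◃⟧ (m ℕ.* n)) (×1-homo-* m n)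
    ⟦*⟧ (+ m)      -[1+ n ]   = R.trans (⟦-◃⟧ (m ℕ.* suc n))
      (R.trans (R.-‿cong (×1-homo-* m (suc n))) (-‿distribʳ-* _ _))
    ⟦*⟧ -[1+ m ]   (+ n)      = R.trans (⟦-◃⟧ (suc m ℕ.* n))
      (R.trans (R.-‿cong (×1-homo-* (suc m) n)) (-‿distribˡ-* _ _))
    ⟦*⟧ -[1+ m ]   -[1+ n ]   = begin
      (suc m ℕ.* suc n) · 1#                 ≈⟨ ×1-homo-* (suc m) (suc n) ⟩
      (suc m · 1#) ⊗ (suc n · 1#)            ≈⟨ -‿involutive _ ⟨
      ⊝ ⊝ ((suc m · 1#) ⊗ (suc n · 1#))      ≈⟨ R.-‿cong (-‿distribʳ-* _ _) ⟩
      ⊝ ((suc m · 1#) ⊗ ⊝ (suc n · 1#))      ≈⟨ -‿distribˡ-* _ _ ⟩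
      ⊝ (suc m · 1#) ⊗ ⊝ (suc n · 1#)        ∎

    ⟦-⟧ : ∀ i → ⟦ ℤ.- i ⟧ᶻ ≈ ⊝ ⟦ i ⟧ᶻ
    ⟦-⟧ (+ zero)   = R.sym -0#≈0#
    ⟦-⟧ (+ suc n)  = R.refl
    ⟦-⟧ -[1+ n ]   = R.sym (-‿involutive _)

    morphism : ℤ.+-*-rawRing -Raw-AlmostCommutative⟶ fromCommutativeRing R
    morphism = record
      { ⟦_⟧    = ⟦_⟧ᶻ
      ; +-homo = ⟦+⟧
      ; *-homo = ⟦*⟧
      ; -‿homo = ⟦-⟧
      ; 0-homo = R.refl
      ; 1-homo = R.+-identityʳ 1#
      }

    equal? : ∀ i j → Maybe (⟦ i ⟧ᶻ ≈ ⟦ j ⟧ᶻ)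
    equal? i j with i ℤ.≟ j
    ... | yes refl = just R.refl
    ... | no  _    = nothing

  open Algebra.Solver.Ring ℤ.+-*-rawRing (fromCommutativeRing R) morphism equal? public
    using (solve; _:=_; _:+_; _:*_; _:-_; :-_; con)

record FiniteOddField : Set₁ where
  infix  8 ⊝_
  infixl 7 _⊗_
  infixl 6 _⊕_
  field
    Carrier           : Set
    _⊕_ _⊗_           : Op₂ Carrier
    ⊝_                : Op₁ Carrier
    0# 1#             : Carrier
    isCommutativeRing : IsCommutativeRing _≡_ _⊕_ _⊗_ ⊝_ 0# 1#
    finite            : Finite Carrier
    inverse           : ∀ {x} → x ≢ 0# → ∃[ y ] y ⊗ x ≡ 1#
    1+1≢0             : 1# ⊕ 1# ≢ 0#

  commutativeRing : CommutativeRing 0ℓ 0ℓ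
  commutativeRing = record { isCommutativeRing = isCommutativeRing }

  open CommutativeRing commutativeRing public using () renaming (_-_ to infixl 6 _⊖_)

module PlaneGeometry (𝔽 : FiniteOddField) where
  open import Data.Integer.Base using (+_)
  open FiniteOddField 𝔽
  open Finite finite using (_≟_)
  private module R = CommutativeRing commutativeRing
  open Algebra.Properties.AbelianGroup R.+-abelianGroup using (x∙y⁻¹≈ε⇒x≈y)
  open IntegerCoefficients commutativeRing

  Plane : Set
  Plane = Carrier × Carrier

  private variable
    s t : Carrier
    x y z x′ y′ z′ : Plane

  dist : Plane → Plane → Carrier
  dist (x₁ , x₂) (y₁ , y₂) = (x₁ ⊖ y₁) ⊗ (x₁ ⊖ y₁) ⊕ (x₂ ⊖ y₂) ⊗ (x₂ ⊖ y₂)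

  -- Up to the factor 1 + s², the coordinates of a point along the orthogonal
  -- directions (1 , s) and (- s , 1).
  along across : Carrier → Plane → Carrier
  along  s (x₁ , x₂) = x₁ ⊕ s ⊗ x₂
  across s (x₁ , x₂) = x₂ ⊖ s ⊗ x₁

  difference : Plane × Plane → Plane
  difference ((x₁ , x₂) , (y₁ , y₂)) = x₁ ⊖ y₁ , x₂ ⊖ y₂

  private
    equal : ∀ a b → a ⊖ b ≡ 0# → a ≡ b
    equal = x∙y⁻¹≈ε⇒x≈y

    -- Most proofs below follow one pattern: the solver certifies that a difference, possibly times
    -- a nonzero factor, is a combination of differences of equal terms, and `vanish` or `vanish₂`
    -- evaluates that combination to zero.
    vanish : ∀ c {a b} → a ≡ b → c ⊗ (a ⊖ b) ≡ 0#
    vanish c {a} refl = trans (cong (c ⊗_) (R.-‿inverseʳ a)) (R.zeroʳ c)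

    vanish₂ : ∀ c {a b} c′ {a′ b′} → a ≡ b → a′ ≡ b′ → c ⊗ (a ⊖ b) ⊕ c′ ⊗ (a′ ⊖ b′) ≡ 0#
    vanish₂ c c′ eq eq′ = trans (cong₂ _⊕_ (vanish c eq) (vanish c′ eq′)) (R.+-identityʳ 0#)

    cancel : ∀ a b → a ≢ 0# → a ⊗ b ≡ 0# → b ≡ 0#
    cancel a b a≢0 ab≡0 = let i , ia≡1 = inverse a≢0 in begin
      b             ≡⟨ R.*-identityˡ b ⟨
      1# ⊗ b        ≡⟨ cong (_⊗ b) ia≡1 ⟨
      i ⊗ a ⊗ b     ≡⟨ R.*-assoc i a b ⟩
      i ⊗ (a ⊗ b)   ≡⟨ cong (i ⊗_) ab≡0 ⟩
      i ⊗ 0#        ≡⟨ R.zeroʳ i ⟩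
      0#            ∎
      where open ≡-Reasoning

    integral : ∀ a b → a ⊗ b ≡ 0# → a ≡ 0# ⊎ b ≡ 0#
    integral a b ab≡0 with a ≟ 0#
    ... | yes a≡0 = inj₁ a≡0
    ... | no  a≢0 = inj₂ (cancel a b a≢0 ab≡0)

    -- Odd characteristic enters the geometry through this cancellation.
    halve : ∀ a b → a ⊕ a ≡ b ⊕ b → a ≡ b
    halve a b eq = equal a b (cancel (1# ⊕ 1#) (a ⊖ b) 1+1≢0 (trans
      (solve 3 (λ u a b → (u :+ u) :* (a :- b) := u :* (a :+ a :- (b :+ b))) refl 1# a b)
      (vanish 1# eq)))

    zero-difference : ∀ {a b} → a ≡ b → a ⊖ b ≡ 0#
    zero-difference {a} refl = R.-‿inverseʳ a

    equal-points : ∀ {a b c d} → a ⊖ c ≡ 0# → b ⊖ d ≡ 0# → (a , b) ≡ (c , d)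
    equal-points a≡c b≡d = cong₂ _,_ (equal _ _ a≡c) (equal _ _ b≡d)

  across-slope-unique : across s x ≡ across s y → across t x ≡ across t y → s ≢ t → x ≡ y
  across-slope-unique {s} {x₁ , x₂} {y₁ , y₂} {t} eqₛ eqₜ s≢t = equal-points Δ₁≡0
    (trans (solve 5 (λ s x₁ x₂ y₁ y₂ →
              x₂ :- y₂ := x₂ :- s :* x₁ :- (y₂ :- s :* y₁) :+ s :* (x₁ :- y₁)) refl s x₁ x₂ y₁ y₂)
       (trans (cong₂ _⊕_ (zero-difference eqₛ) (trans (cong (s ⊗_) Δ₁≡0) (R.zeroʳ s))) (R.+-identityʳ 0#)))
    where
    Δ₁≡0 : x₁ ⊖ y₁ ≡ 0#
    Δ₁≡0 = cancel (s ⊖ t) (x₁ ⊖ y₁) (λ s-t≡0 → s≢t (equal s t s-t≡0)) (trans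
      (solve 7 (λ s t x₁ x₂ y₁ y₂ u → (s :- t) :* (x₁ :- y₁) :=
                 con (+ 1) :* (x₂ :- t :* x₁ :- (y₂ :- t :* y₁)) :+
                 (:- con (+ 1)) :* (x₂ :- s :* x₁ :- (y₂ :- s :* y₁))) refl s t x₁ x₂ y₁ y₂ 1#)
      (vanish₂ _ _ eqₜ eqₛ))

  -- Doubled values appear because the bisector of y and z is described by along y + along z = 2
  -- along x, which avoids halving. Lines orthogonal to (1 , s) and to (1 , t) meet in one point.
  along-slope-unique : along s x ⊕ along s x ≡ along s y ⊕ along s y →
                       along t x ⊕ along t x ≡ along t y ⊕ along t y → s ≢ t → x ≡ y
  along-slope-unique {s} {x₁ , x₂} {y₁ , y₂} {t} eqₛ eqₜ s≢t = equal-points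
    (trans (solve 5 (λ s x₁ x₂ y₁ y₂ →
              x₁ :- y₁ := x₁ :+ s :* x₂ :- (y₁ :+ s :* y₂) :- s :* (x₂ :- y₂)) refl s x₁ x₂ y₁ y₂)
       (trans (cong₂ _⊖_ (zero-difference eqₛ′) (trans (cong (s ⊗_) Δ₂≡0) (R.zeroʳ s))) (R.-‿inverseʳ 0#)))
    Δ₂≡0
    where
    eqₛ′ = halve _ _ eqₛ
    eqₜ′ = halve _ _ eqₜ
    Δ₂≡0 : x₂ ⊖ y₂ ≡ 0#
    Δ₂≡0 = cancel (s ⊖ t) (x₂ ⊖ y₂) (λ s-t≡0 → s≢t (equal s t s-t≡0)) (trans
      (solve 6 (λ s t x₁ x₂ y₁ y₂ → (s :- t) :* (x₂ :- y₂) :=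
                 con (+ 1) :* (x₁ :+ s :* x₂ :- (y₁ :+ s :* y₂)) :+
                 (:- con (+ 1)) :* (x₁ :+ t :* x₂ :- (y₁ :+ t :* y₂))) refl s t x₁ x₂ y₁ y₂)
      (vanish₂ _ _ eqₛ′ eqₜ′))

  isotropic-slopes : 1# ⊕ s ⊗ s ≡ 0# → 1# ⊕ t ⊗ t ≡ 0# → t ≡ s ⊎ t ≡ ⊝ s
  isotropic-slopes {s} {t} iso iso′ =
    [ (λ eq → inj₁ (equal t s eq))
    , (λ eq → inj₂ (equal t (⊝ s) (trans (solve 2 (λ s t → t :- (:- s) := t :+ s) refl s t) eq))) ]′
    (integral (t ⊖ s) (t ⊕ s) (trans
      (solve 3 (λ s t u → (t :- s) :* (t :+ s) := con (+ 1) :* (u :+ t :* t :- (u :+ s :* s)))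
             refl s t 1#)
      (vanish _ (trans iso′ (sym iso)))))

  dist-zero-fibre : ∀ {x y₁ a b} → dist x (y₁ , a) ≡ 0# → dist x (y₁ , b) ≡ 0# →
                    b ≡ a ⊎ b ≡ proj₂ x ⊕ proj₂ x ⊖ a
  dist-zero-fibre {x₁ , x₂} {y₁} {a} {b} eq eq′ =
    [ (λ eq → inj₁ (equal b a eq)) , (λ eq → inj₂ (equal b (x₂ ⊕ x₂ ⊖ a) eq)) ]′
    (integral (b ⊖ a) (b ⊖ (x₂ ⊕ x₂ ⊖ a)) (trans
      (solve 5 (λ x₁ x₂ y₁ a b → (b :- a) :* (b :- (x₂ :+ x₂ :- a)) :=
                 con (+ 1) :* ((x₁ :- y₁) :* (x₁ :- y₁) :+ (x₂ :- b) :* (x₂ :- b) :-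
                               ((x₁ :- y₁) :* (x₁ :- y₁) :+ (x₂ :- a) :* (x₂ :- a))))
             refl x₁ x₂ y₁ a b)
      (vanish _ (trans eq′ (sym eq)))))

  Anisotropic : Carrier → Set
  Anisotropic s = 1# ⊕ s ⊗ s ≢ 0#

  -- The reflections in the lines along s w ≡ c, for varying c, match the pairs p
  -- and p′ for which frame s p ≡ coframe s p′.
  frame coframe : Carrier → Plane × Plane → Plane
  frame   s (x , y) = across s x ⊖ across s y , along s x ⊖ along s y
  coframe s (x , y) = across s x ⊖ across s y , along s y ⊖ along s x

  -- On the difference (a , b) of a pair, `frame s` is the linear map to (b - s a , a + s b), whose
  -- determinant is -(1 + s²).
  frame-injective : Anisotropic s → frame s (x , y) ≡ frame s (x′ , y′) →
                    difference (x , y) ≡ difference (x′ , y′)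
  frame-injective {s} {x₁ , x₂} {y₁ , y₂} {x₁′ , x₂′} {y₁′ , y₂′} aniso eq = equal-points
    (cancel (1# ⊕ s ⊗ s) _ aniso (trans
      (solve 10 (λ s x₁ x₂ y₁ y₂ x₁′ x₂′ y₁′ y₂′ u →
        (u :+ s :* s) :* (x₁ :- y₁ :- (x₁′ :- y₁′)) :=
        u :* (x₁ :- y₁ :- (x₁′ :- y₁′)) :+ s :* s :* (x₁ :- y₁ :- (x₁′ :- y₁′)))
        refl s x₁ x₂ y₁ y₂ x₁′ x₂′ y₁′ y₂′ 1#)
      (trans (cong (_⊕ s ⊗ s ⊗ (x₁ ⊖ y₁ ⊖ (x₁′ ⊖ y₁′))) (R.*-identityˡ _))
      (trans (solve 9 (λ s x₁ x₂ y₁ y₂ x₁′ x₂′ y₁′ y₂′ →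
        x₁ :- y₁ :- (x₁′ :- y₁′) :+ s :* s :* (x₁ :- y₁ :- (x₁′ :- y₁′)) :=
        con (+ 1) :* (x₁ :+ s :* x₂ :- (y₁ :+ s :* y₂) :- (x₁′ :+ s :* x₂′ :- (y₁′ :+ s :* y₂′))) :+
        (:- s) :* (x₂ :- s :* x₁ :- (y₂ :- s :* y₁) :- (x₂′ :- s :* x₁′ :- (y₂′ :- s :* y₁′))))
        refl s x₁ x₂ y₁ y₂ x₁′ x₂′ y₁′ y₂′)
      (vanish₂ _ _ (cong proj₂ eq) (cong proj₁ eq))))))
    (cancel (1# ⊕ s ⊗ s) _ aniso (trans
      (solve 10 (λ s x₁ x₂ y₁ y₂ x₁′ x₂′ y₁′ y₂′ u →
        (u :+ s :* s) :* (x₂ :- y₂ :- (x₂′ :- y₂′)) :=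
        u :* (x₂ :- y₂ :- (x₂′ :- y₂′)) :+ s :* s :* (x₂ :- y₂ :- (x₂′ :- y₂′)))
        refl s x₁ x₂ y₁ y₂ x₁′ x₂′ y₁′ y₂′ 1#)
      (trans (cong (_⊕ s ⊗ s ⊗ (x₂ ⊖ y₂ ⊖ (x₂′ ⊖ y₂′))) (R.*-identityˡ _))
      (trans (solve 9 (λ s x₁ x₂ y₁ y₂ x₁′ x₂′ y₁′ y₂′ →
        x₂ :- y₂ :- (x₂′ :- y₂′) :+ s :* s :* (x₂ :- y₂ :- (x₂′ :- y₂′)) :=
        s :* (x₁ :+ s :* x₂ :- (y₁ :+ s :* y₂) :- (x₁′ :+ s :* x₂′ :- (y₁′ :+ s :* y₂′))) :+
        con (+ 1) :* (x₂ :- s :* x₁ :- (y₂ :- s :* y₁) :- (x₂′ :- s :* x₁′ :- (y₂′ :- s :* y₁′))))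
        refl s x₁ x₂ y₁ y₂ x₁′ x₂′ y₁′ y₂′)
      (vanish₂ _ _ (cong proj₂ eq) (cong proj₁ eq))))))

  coframe⇒frame : coframe s (x , y) ≡ coframe s (x′ , y′) → frame s (x , y) ≡ frame s (x′ , y′)
  coframe⇒frame {s} {x} {y} {x′} {y′} eq = cong₂ _,_ (cong proj₁ eq)
    (trans (negated (along s x) (along s y))
      (trans (cong ⊝_ (cong proj₂ eq)) (sym (negated (along s x′) (along s y′)))))
    where
    negated : ∀ a b → a ⊖ b ≡ ⊝ (b ⊖ a)
    negated = solve 2 (λ a b → a :- b := :- (b :- a)) refl

  frame-cong : difference (x , y) ≡ difference (x′ , y′) → frame s (x , y) ≡ frame s (x′ , y′)
  frame-cong {x₁ , x₂} {y₁ , y₂} {x₁′ , x₂′} {y₁′ , y₂′} {s} eq = cong₂ _,_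
    (trans (linᶜ x₁ x₂ y₁ y₂) (trans (cong (λ (a , b) → b ⊖ s ⊗ a) eq) (sym (linᶜ x₁′ x₂′ y₁′ y₂′))))
    (trans (linᵃ x₁ x₂ y₁ y₂) (trans (cong (λ (a , b) → a ⊕ s ⊗ b) eq) (sym (linᵃ x₁′ x₂′ y₁′ y₂′))))
    where
    linᶜ : ∀ x₁ x₂ y₁ y₂ → x₂ ⊖ s ⊗ x₁ ⊖ (y₂ ⊖ s ⊗ y₁) ≡ x₂ ⊖ y₂ ⊖ s ⊗ (x₁ ⊖ y₁)
    linᶜ = solve 5 (λ s x₁ x₂ y₁ y₂ →
      x₂ :- s :* x₁ :- (y₂ :- s :* y₁) := x₂ :- y₂ :- s :* (x₁ :- y₁)) refl s
    linᵃ : ∀ x₁ x₂ y₁ y₂ → x₁ ⊕ s ⊗ x₂ ⊖ (y₁ ⊕ s ⊗ y₂) ≡ x₁ ⊖ y₁ ⊕ s ⊗ (x₂ ⊖ y₂)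
    linᵃ = solve 5 (λ s x₁ x₂ y₁ y₂ →
      x₁ :+ s :* x₂ :- (y₁ :+ s :* y₂) := x₁ :- y₁ :+ s :* (x₂ :- y₂)) refl s

  frame⇒coframe : frame s (x , y) ≡ frame s (x′ , y′) → coframe s (x , y) ≡ coframe s (x′ , y′)
  frame⇒coframe {s} {x} {y} {x′} {y′} eq = cong₂ _,_ (cong proj₁ eq)
    (trans (negated (along s y) (along s x))
      (trans (cong ⊝_ (cong proj₂ eq)) (sym (negated (along s y′) (along s x′)))))
    where
    negated : ∀ a b → a ⊖ b ≡ ⊝ (b ⊖ a)
    negated = solve 2 (λ a b → a :- b := :- (b :- a)) refl

  frame-slope-unique :
    frame s (x , y) ≡ frame s (x′ , y′) → across s y ≡ across s y′ →
    frame t (x , y) ≡ frame t (x′ , y′) → across t y ≡ across t y′ →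
    s ≢ t → (x , y) ≡ (x′ , y′)
  frame-slope-unique {s} {x} {y} {x′} {y′} {t} fₛ kₛ fₜ kₜ s≢t = cong₂ _,_
    (across-slope-unique (first fₛ kₛ) (first fₜ kₜ) s≢t)
    (across-slope-unique kₛ kₜ s≢t)
    where
    restore : ∀ a b → a ⊖ b ⊕ b ≡ a
    restore = solve 2 (λ a b → a :- b :+ b := a) refl
    first : ∀ {r} → frame r (x , y) ≡ frame r (x′ , y′) → across r y ≡ across r y′ →
            across r x ≡ across r x′
    first {r} f k = trans (sym (restore (across r x) (across r y)))
      (trans (cong₂ _⊕_ (cong proj₁ f) k) (restore (across r x′) (across r y′)))

  -- For a difference vector, across² + along² is 1 + s² times its norm, and a reflection changes
  -- only the sign of along. The identity used here avoids division by 1 + s², so that isotropic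
  -- slopes, over which `mirrors-≤` also sums, are covered.
  reflection-isometry : frame s (x , y) ≡ coframe s (x′ , y′) → dist x y ≡ dist x′ y′
  reflection-isometry {s} {x₁ , x₂} {y₁ , y₂} {x₁′ , x₂′} {y₁′ , y₂′} eq = equal _ _ (trans
    (solve 9 (λ s x₁ x₂ y₁ y₂ x₁′ x₂′ y₁′ y₂′ →
      (x₁ :- y₁) :* (x₁ :- y₁) :+ (x₂ :- y₂) :* (x₂ :- y₂) :-
      ((x₁′ :- y₁′) :* (x₁′ :- y₁′) :+ (x₂′ :- y₂′) :* (x₂′ :- y₂′)) :=
      (x₁ :- y₁ :- (x₁′ :- y₁′)) :*
      (x₁ :+ s :* x₂ :- (y₁ :+ s :* y₂) :- (y₁′ :+ s :* y₂′ :- (x₁′ :+ s :* x₂′))) :+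
      (x₂ :- y₂ :+ (x₂′ :- y₂′)) :*
      (x₂ :- s :* x₁ :- (y₂ :- s :* y₁) :- (x₂′ :- s :* x₁′ :- (y₂′ :- s :* y₁′))))
      refl s x₁ x₂ y₁ y₂ x₁′ x₂′ y₁′ y₂′)
    (vanish₂ _ _ (cong proj₂ eq) (cong proj₁ eq)))

  -- A nonzero vector and its image determine the reflection. Subtracting the equations for s and t
  -- shows that the difference (a , b) has image (a , - b); put back into the equations for s this
  -- gives 2 b = 0 and 2 a = 0.
  reflection-slope-unique :
    frame s (x , y) ≡ coframe s (x′ , y′) → frame t (x , y) ≡ coframe t (x′ , y′) →
    s ≢ t → x ≡ y × x′ ≡ y′
  reflection-slope-unique {s} {x₁ , x₂} {y₁ , y₂} {x₁′ , x₂′} {y₁′ , y₂′} {t} eqₛ eqₜ s≢t =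
    equal-points δ₁≡0 δ₂≡0 ,
    equal-points (trans (sym δ₁≡δ₁′) δ₁≡0)
      (trans (solve 2 (λ b b′ → b′ := b :+ b′ :- b) refl (x₂ ⊖ y₂) (x₂′ ⊖ y₂′))
        (trans (cong₂ _⊖_ δ₂+δ₂′≡0 δ₂≡0) (R.-‿inverseʳ 0#)))
    where
    s-t≢0 : s ⊖ t ≢ 0#
    s-t≢0 s-t≡0 = s≢t (equal s t s-t≡0)
    δ₁≡δ₁′ : x₁ ⊖ y₁ ≡ x₁′ ⊖ y₁′
    δ₁≡δ₁′ = equal _ _ (cancel (s ⊖ t) _ s-t≢0 (trans
      (solve 10 (λ s t x₁ x₂ y₁ y₂ x₁′ x₂′ y₁′ y₂′ →
        (s :- t) :* (x₁ :- y₁ :- (x₁′ :- y₁′)) :=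
        con (+ 1) :*
        (x₂ :- t :* x₁ :- (y₂ :- t :* y₁) :- (x₂′ :- t :* x₁′ :- (y₂′ :- t :* y₁′))) :+
        (:- con (+ 1)) :*
        (x₂ :- s :* x₁ :- (y₂ :- s :* y₁) :- (x₂′ :- s :* x₁′ :- (y₂′ :- s :* y₁′))))
        refl s t x₁ x₂ y₁ y₂ x₁′ x₂′ y₁′ y₂′)
      (vanish₂ _ _ (cong proj₁ eqₜ) (cong proj₁ eqₛ))))
    δ₂+δ₂′≡0 : x₂ ⊖ y₂ ⊕ (x₂′ ⊖ y₂′) ≡ 0#
    δ₂+δ₂′≡0 = cancel (s ⊖ t) _ s-t≢0 (trans
      (solve 10 (λ s t x₁ x₂ y₁ y₂ x₁′ x₂′ y₁′ y₂′ →
        (s :- t) :* (x₂ :- y₂ :+ (x₂′ :- y₂′)) :=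
        con (+ 1) :*
        (x₁ :+ s :* x₂ :- (y₁ :+ s :* y₂) :- (y₁′ :+ s :* y₂′ :- (x₁′ :+ s :* x₂′))) :+
        (:- con (+ 1)) :*
        (x₁ :+ t :* x₂ :- (y₁ :+ t :* y₂) :- (y₁′ :+ t :* y₂′ :- (x₁′ :+ t :* x₂′))))
        refl s t x₁ x₂ y₁ y₂ x₁′ x₂′ y₁′ y₂′)
      (vanish₂ _ _ (cong proj₂ eqₛ) (cong proj₂ eqₜ)))
    δ₂≡0 : x₂ ⊖ y₂ ≡ 0#
    δ₂≡0 = halve _ 0# (trans (equal _ 0# (trans
      (solve 10 (λ s x₁ x₂ y₁ y₂ x₁′ x₂′ y₁′ y₂′ o →
        x₂ :- y₂ :+ (x₂ :- y₂) :- o :=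
        (con (+ 1) :*
        (x₂ :- s :* x₁ :- (y₂ :- s :* y₁) :- (x₂′ :- s :* x₁′ :- (y₂′ :- s :* y₁′))) :+
        s :* (x₁ :- y₁ :- (x₁′ :- y₁′))) :+ (x₂ :- y₂ :+ (x₂′ :- y₂′) :- o))
        refl s x₁ x₂ y₁ y₂ x₁′ x₂′ y₁′ y₂′ 0#)
      (trans (cong₂ _⊕_ (vanish₂ _ _ (cong proj₁ eqₛ) δ₁≡δ₁′) (zero-difference δ₂+δ₂′≡0))
             (R.+-identityʳ 0#)))) (sym (R.+-identityʳ 0#)))
    δ₁≡0 : x₁ ⊖ y₁ ≡ 0#
    δ₁≡0 = halve _ 0# (trans (equal _ 0# (trans
      (solve 10 (λ s x₁ x₂ y₁ y₂ x₁′ x₂′ y₁′ y₂′ o →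
        x₁ :- y₁ :+ (x₁ :- y₁) :- o :=
        (con (+ 1) :*
        (x₁ :+ s :* x₂ :- (y₁ :+ s :* y₂) :- (y₁′ :+ s :* y₂′ :- (x₁′ :+ s :* x₂′))) :+
        con (+ 1) :* (x₁ :- y₁ :- (x₁′ :- y₁′))) :+
        ((:- s) :* (x₂ :- y₂ :+ (x₂′ :- y₂′) :- o) :+ (con (+ 1) :+ s) :* (o :- (o :+ o))))
        refl s x₁ x₂ y₁ y₂ x₁′ x₂′ y₁′ y₂′ 0#)
      (trans (cong₂ _⊕_ (vanish₂ _ _ (cong proj₂ eqₛ) δ₁≡δ₁′)
                        (vanish₂ _ _ δ₂+δ₂′≡0 (sym (R.+-identityʳ 0#))))
             (R.+-identityʳ 0#)))) (sym (R.+-identityʳ 0#)))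

  -- x lies on the perpendicular bisector of y and z. The parameter s covers the directions (1 , s)
  -- only, so a vertical segment yz is treated separately; there z is the mirror image of y in the
  -- horizontal line through x.
  isosceles : dist x y ≡ dist x z → dist x y ≢ 0# → y ≢ z →
    (proj₁ z ≡ proj₁ y × proj₂ z ≡ proj₂ x ⊕ proj₂ x ⊖ proj₂ y) ⊎
    (∃[ s ] Anisotropic s × across s y ≡ across s z × along s y ⊕ along s z ≡ along s x ⊕ along s x)
  isosceles {x₁ , x₂} {y₁ , y₂} {z₁ , z₂} eq d≢0 y≢z with z₁ ≟ y₁
  ... | yes refl = inj₁ (refl , equal _ _ (cancel (z₂ ⊖ y₂) _
      (λ z₂-y₂≡0 → y≢z (cong (z₁ ,_) (sym (equal z₂ y₂ z₂-y₂≡0)))) (trans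
      (solve 5 (λ x₁ x₂ y₁ y₂ z₂ → (z₂ :- y₂) :* (z₂ :- (x₂ :+ x₂ :- y₂)) :=
        (:- con (+ 1)) :* ((x₁ :- y₁) :* (x₁ :- y₁) :+ (x₂ :- y₂) :* (x₂ :- y₂) :-
                           ((x₁ :- y₁) :* (x₁ :- y₁) :+ (x₂ :- z₂) :* (x₂ :- z₂))))
        refl x₁ x₂ y₁ y₂ z₂)
      (vanish _ eq))))
  ... | no z₁≢y₁ = inj₂ (σ , aniso , acrossʸ≡acrossᶻ , alongʸ+alongᶻ)
    where
    Δ₁≢0 : z₁ ⊖ y₁ ≢ 0#
    Δ₁≢0 Δ₁≡0 = z₁≢y₁ (equal z₁ y₁ Δ₁≡0)
    σ = (z₂ ⊖ y₂) ⊗ proj₁ (inverse Δ₁≢0)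
    slope : σ ⊗ (z₁ ⊖ y₁) ≡ z₂ ⊖ y₂
    slope = trans (R.*-assoc _ _ _) (trans (cong ((z₂ ⊖ y₂) ⊗_) (proj₂ (inverse Δ₁≢0))) (R.*-identityʳ _))
    acrossʸ≡acrossᶻ : y₂ ⊖ σ ⊗ y₁ ≡ z₂ ⊖ σ ⊗ z₁
    acrossʸ≡acrossᶻ = equal _ _ (trans
      (solve 5 (λ σ y₁ y₂ z₁ z₂ → y₂ :- σ :* y₁ :- (z₂ :- σ :* z₁) :=
        con (+ 1) :* (σ :* (z₁ :- y₁) :- (z₂ :- y₂))) refl σ y₁ y₂ z₁ z₂)
      (vanish _ slope))
    alongʸ+alongᶻ : y₁ ⊕ σ ⊗ y₂ ⊕ (z₁ ⊕ σ ⊗ z₂) ≡ x₁ ⊕ σ ⊗ x₂ ⊕ (x₁ ⊕ σ ⊗ x₂)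
    alongʸ+alongᶻ = equal _ _ (cancel (z₁ ⊖ y₁) _ Δ₁≢0 (trans
      (solve 7 (λ σ x₁ x₂ y₁ y₂ z₁ z₂ →
        (z₁ :- y₁) :* (y₁ :+ σ :* y₂ :+ (z₁ :+ σ :* z₂) :- (x₁ :+ σ :* x₂ :+ (x₁ :+ σ :* x₂))) :=
        (:- con (+ 1)) :* ((x₁ :- y₁) :* (x₁ :- y₁) :+ (x₂ :- y₂) :* (x₂ :- y₂) :-
                           ((x₁ :- z₁) :* (x₁ :- z₁) :+ (x₂ :- z₂) :* (x₂ :- z₂))) :+
        (y₂ :+ z₂ :- (x₂ :+ x₂)) :* (σ :* (z₁ :- y₁) :- (z₂ :- y₂)))
        refl σ x₁ x₂ y₁ y₂ z₁ z₂)
      (vanish₂ _ _ eq slope)))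
    -- An isotropic direction is orthogonal to itself, so y and z have equal `along`, and so does x
    -- by the midpoint equation. As dist x y has the factor along x - along y when 1 + σ² = 0, it
    -- would vanish.
    aniso : Anisotropic σ
    aniso isotropic = d≢0 (trans
      (solve 5 (λ σ x₁ x₂ y₁ y₂ →
        (x₁ :- y₁) :* (x₁ :- y₁) :+ (x₂ :- y₂) :* (x₂ :- y₂) :=
        (x₁ :- y₁ :- σ :* (x₂ :- y₂)) :* (x₁ :+ σ :* x₂ :- (y₁ :+ σ :* y₂)) :+
        ((con (+ 1) :+ σ :* σ) :* (x₂ :- y₂)) :* (x₂ :- y₂))
        refl σ x₁ x₂ y₁ y₂)
      (trans (cong₂ _⊕_
        (trans (cong ((x₁ ⊖ y₁ ⊖ σ ⊗ (x₂ ⊖ y₂)) ⊗_) (zero-difference alongˣ≡alongʸ)) (R.zeroʳ _))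
        (trans (cong (_⊗ (x₂ ⊖ y₂)) (trans (cong (_⊗ (x₂ ⊖ y₂)) isotropic′) (R.zeroˡ _))) (R.zeroˡ _)))
        (R.+-identityʳ 0#)))
      where
      -- The solver evaluates `con (+ 1)` to the multiple `1 · 1#`, which is `1# ⊕ 0#`.
      isotropic′ : 1# ⊕ 0# ⊕ σ ⊗ σ ≡ 0#
      isotropic′ = trans (cong (_⊕ σ ⊗ σ) (R.+-identityʳ 1#)) isotropic
      alongˣ≡alongʸ : x₁ ⊕ σ ⊗ x₂ ≡ y₁ ⊕ σ ⊗ y₂
      alongˣ≡alongʸ = halve _ _ (trans (sym alongʸ+alongᶻ) (R.+-congˡ (equal _ _ (trans
        (solve 5 (λ σ y₁ y₂ z₁ z₂ → z₁ :+ σ :* z₂ :- (y₁ :+ σ :* y₂) :=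
          (con (+ 1) :+ σ :* σ) :* (z₁ :- y₁) :+ (:- σ) :* (σ :* (z₁ :- y₁) :- (z₂ :- y₂)))
          refl σ y₁ y₂ z₁ z₂)
        (trans (cong₂ _⊕_ (trans (cong (_⊗ (z₁ ⊖ y₁)) isotropic′) (R.zeroˡ _)) (vanish (⊝ σ) slope))
               (R.+-identityʳ 0#))))))

  difference-injective : difference (x , y) ≡ difference (x , z) → y ≡ z
  difference-injective {x₁ , x₂} {y₁ , y₂} {z₁ , z₂} eq =
    cong₂ _,_ (solved x₁ y₁ z₁ (cong proj₁ eq)) (solved x₂ y₂ z₂ (cong proj₂ eq))
    where
    solved : ∀ a b c → a ⊖ b ≡ a ⊖ c → b ≡ c
    solved a b c eq = equal b c (trans
      (solve 3 (λ a b c → b :- c := (:- con (+ 1)) :* (a :- b :- (a :- c))) refl a b c)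
      (vanish _ eq))

  reflection⇒frame≡coframe : across s x ≡ across s x′ → across s y ≡ across s y′ →
    along s x ⊕ along s x′ ≡ along s y ⊕ along s y′ → frame s (x , y) ≡ coframe s (x′ , y′)
  reflection⇒frame≡coframe {s} {x} {x′} {y} {y′} eqˣ eqʸ eq = cong₂ _,_ (cong₂ _⊖_ eqˣ eqʸ)
    (equal _ _ (trans
      (solve 4 (λ a a′ b b′ → a :- b :- (b′ :- a′) := con (+ 1) :* (a :+ a′ :- (b :+ b′)))
        refl (along s x) (along s x′) (along s y) (along s y′))
      (vanish _ eq)))

  Anisotropic? : ∀ s → Dec (Anisotropic s)
  Anisotropic? s = ¬? (1# ⊕ s ⊗ s ≟ 0#)

-- The energy bound

infixr 2 _×ᶠ_
_×ᶠ_ : Finite A → Finite B → Finite (A × B)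
𝔸 ×ᶠ 𝔹 = record
  { _≟_      = Product.≡-dec 𝔸._≟_ 𝔹._≟_
  ; elements = cartesianProduct 𝔸.elements 𝔹.elements
  ; unique   = Unique.cartesianProduct⁺ 𝔸.unique 𝔹.unique
  ; complete = λ (a , b) → ∈-cartesianProduct⁺ (𝔸.complete a) (𝔹.complete b)
  }
  where
  module 𝔸 = Finite 𝔸
  module 𝔹 = Finite 𝔹

∑-≥ : ∀ {xs : List A} {x} (f : A → ℕ) → x ∈ xs → f x ≤ ∑ xs f
∑-≥ f (here refl) = m≤m+n _ _
∑-≥ f (there x∈)  = ≤-trans (∑-≥ f x∈) (m≤n+m _ _)

private
  -- Closes the circle between J, N and Q. Since N ≤ n (2 n² + J), the bound for q Q contains n J;
  -- multiplied by q² this is n q (q J) ≤ κ n² (q J), half of the left side of the incidence bound.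
  -- All other terms are O(n⁵): for 6 n² q⁴ this is the hypothesis on q⁴, for the rest q ≤ κ n
  -- suffices.
  energy-arithmetic : ∀ n q κ {J Q N Z T A} .{{_ : NonZero n}} .{{_ : NonZero q}} .{{_ : NonZero κ}} →
    q * q * q * q ≤ κ * n * (κ * n) * (κ * n) → q ≤ κ * n →
    N ≤ n * T → T ≤ n * n * 2 + J → Z ≤ n * (q * 2) → A ≤ n * (n * n) →
    q * Q ≤ N + Z * Z + q * (n * n) + q * (q * (n * n)) + 2 * A →
    2 * (κ * (n * n) * (q * J)) ≤
      q * q * (q * Q) + 2 * (κ * (n * n * n) * (n * n + n * q)) + κ * κ * (n * n * n * n * n) →
    q * N ≤ (6 * (κ * κ) + 9 * κ + 2) * (n * n * n * n)
  energy-arithmetic n q κ {J} {Q} {N} {Z} {T} {A} q⁴≤ q≤ N≤nT T≤ Z≤ A≤ qQ≤ incidence = begin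
    q * N                                    ≤⟨ *-monoʳ-≤ q N≤ ⟩
    q * (n * (n * n * 2 + J))                ≡⟨ e₁ q n J ⟩
    n * (n * n * 2 * q + q * J)              ≤⟨ *-monoʳ-≤ n (+-mono-≤ (*-monoʳ-≤ (n * n * 2) q≤) qJ≤) ⟩
    n * (n * n * 2 * (κ * n) + (6 * (κ * κ) + 7 * κ + 2) * (n * n * n))
                                             ≡⟨ e₂ n κ ⟩
    (6 * (κ * κ) + 9 * κ + 2) * (n * n * n * n) ∎
    where
    open ≤-Reasoning
    e₁ : ∀ q n J → q * (n * (n * n * 2 + J)) ≡ n * (n * n * 2 * q + q * J)
    e₁ = solve-∀
    e₂ : ∀ n κ → n * (n * n * 2 * (κ * n) + (6 * (κ * κ) + 7 * κ + 2) * (n * n * n)) ≡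
                 (6 * (κ * κ) + 9 * κ + 2) * (n * n * n * n)
    e₂ = solve-∀
    N≤ : N ≤ n * (n * n * 2 + J)
    N≤ = ≤-trans N≤nT (*-monoʳ-≤ n T≤)
    qQ≤′ : q * Q ≤ n * J + 4 * (n * n * n) + 6 * (n * n) * (q * q)
    qQ≤′ = begin
      q * Q ≤⟨ qQ≤ ⟩
      N + Z * Z + q * (n * n) + q * (q * (n * n)) + 2 * A
        ≤⟨ +-mono-≤ (+-monoˡ-≤ (q * (q * (n * n))) (+-mono-≤ (+-mono-≤ N≤ (*-mono-≤ Z≤ Z≤))
             (*-monoʳ-≤ q (m≤n*m (n * n) q)))) (*-monoʳ-≤ 2 A≤) ⟩
      n * (n * n * 2 + J) + n * (q * 2) * (n * (q * 2)) + q * (q * (n * n)) + q * (q * (n * n))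
        + 2 * (n * (n * n))
        ≡⟨ e₃ n q J ⟩
      n * J + 4 * (n * n * n) + 6 * (n * n) * (q * q) ∎
      where
      e₃ : ∀ n q J → n * (n * n * 2 + J) + n * (q * 2) * (n * (q * 2)) + q * (q * (n * n))
             + q * (q * (n * n)) + 2 * (n * (n * n)) ≡ n * J + 4 * (n * n * n) + 6 * (n * n) * (q * q)
      e₃ = solve-∀
    qJ≤ : q * J ≤ (6 * (κ * κ) + 7 * κ + 2) * (n * n * n)
    -- One of the two copies of κ n² (q J) is spent on absorbing the recurring term; the other one
    -- carries the bound.
    qJ≤ = *-cancelˡ-≤ (κ * (n * n)) {{m*n≢0 κ (n * n) {{it}} {{m*n≢0 n n}}}}
      (+-cancelˡ-≤ (κ * (n * n) * (q * J)) _ _ (begin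
      κ * (n * n) * (q * J) + κ * (n * n) * (q * J)
        ≡⟨ e₄ (κ * (n * n) * (q * J)) ⟨
      2 * (κ * (n * n) * (q * J))
        ≤⟨ incidence ⟩
      q * q * (q * Q) + 2 * (κ * (n * n * n) * (n * n + n * q)) + κ * κ * (n * n * n * n * n)
        ≤⟨ +-monoˡ-≤ (κ * κ * (n * n * n * n * n)) (+-mono-≤ (*-monoʳ-≤ (q * q) qQ≤′)
             (*-monoʳ-≤ 2 (*-monoʳ-≤ (κ * (n * n * n)) (+-monoʳ-≤ (n * n) (*-monoʳ-≤ n q≤))))) ⟩
      q * q * (n * J + 4 * (n * n * n) + 6 * (n * n) * (q * q))
        + 2 * (κ * (n * n * n) * (n * n + n * (κ * n))) + κ * κ * (n * n * n * n * n)
        ≡⟨ cong (λ m → m + 2 * (κ * (n * n * n) * (n * n + n * (κ * n))) + κ * κ * (n * n * n * n * n))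
             (e₅ q n J) ⟩
      n * q * (q * J) + 4 * (n * n * n) * (q * q) + 6 * (n * n) * (q * q * q * q)
        + 2 * (κ * (n * n * n) * (n * n + n * (κ * n))) + κ * κ * (n * n * n * n * n)
        ≤⟨ +-monoˡ-≤ (κ * κ * (n * n * n * n * n))
             (+-monoˡ-≤ (2 * (κ * (n * n * n) * (n * n + n * (κ * n))))
               (+-mono-≤ (+-mono-≤ (*-monoˡ-≤ (q * J) (*-monoʳ-≤ n q≤))
                                   (*-monoʳ-≤ (4 * (n * n * n)) (*-mono-≤ q≤ q≤)))
                         (*-monoʳ-≤ (6 * (n * n)) q⁴≤))) ⟩
      n * (κ * n) * (q * J) + 4 * (n * n * n) * (κ * n * (κ * n))
        + 6 * (n * n) * (κ * n * (κ * n) * (κ * n))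
        + 2 * (κ * (n * n * n) * (n * n + n * (κ * n))) + κ * κ * (n * n * n * n * n)
        ≡⟨ e₆ κ n (q * J) ⟩
      κ * (n * n) * (q * J) + κ * (n * n) * ((6 * (κ * κ) + 7 * κ + 2) * (n * n * n)) ∎))
      where
      e₄ : ∀ m → 2 * m ≡ m + m
      e₄ = solve-∀
      e₅ : ∀ q n J → q * q * (n * J + 4 * (n * n * n) + 6 * (n * n) * (q * q)) ≡
             n * q * (q * J) + 4 * (n * n * n) * (q * q) + 6 * (n * n) * (q * q * q * q)
      e₅ = solve-∀
      e₆ : ∀ κ n X → n * (κ * n) * X + 4 * (n * n * n) * (κ * n * (κ * n))
             + 6 * (n * n) * (κ * n * (κ * n) * (κ * n))
             + 2 * (κ * (n * n * n) * (n * n + n * (κ * n))) + κ * κ * (n * n * n * n * n) ≡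
             κ * (n * n) * X + κ * (n * n) * ((6 * (κ * κ) + 7 * κ + 2) * (n * n * n))
      e₆ = solve-∀

module Energy (𝔽 : FiniteOddField) {E : List (PlaneGeometry.Plane 𝔽)} (uniqueᴱ : Unique E) where
  open FiniteOddField 𝔽 using (Carrier; 0#; 1#; finite; _⊕_; _⊗_; _⊖_; ⊝_)
  open PlaneGeometry 𝔽
  open Finite finite using (_≟_; order; elements; fibre; ∑-fibre; ∑-fibre²)

  private
    plane : Finite Plane
    plane = finite ×ᶠ finite
    module plane = Finite plane
    module pairs = Finite (plane ×ᶠ plane)

  n q : ℕ
  n = length E
  q = order

  E² : List (Plane × Plane)
  E² = cartesianProduct E E

  private
    ∑-E² : ∀ f → ∑ E² f ≡ ∑ E (λ x → ∑ E (λ y → f (x , y)))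
    ∑-E² = ∑-cartesianProductWith _,_ E E

    ∑²-≤ : ∀ {f c} → (∀ x → f x ≤ c) → ∑ E² f ≤ n * (n * c)
    ∑²-≤ le = ≤-trans (≤-reflexive (∑-E² _)) (∑-≤ E (λ x → ∑-≤ E (λ y → le (x , y))))

    diagonal : ∀ x → ∑ E (λ y → ⟦ x plane.≟ y ⟧) ≤ 1
    diagonal x = count-≤1 (x plane.≟_) uniqueᴱ (λ _ _ x≡y x≡z → trans (sym x≡y) x≡z)

    -- P is a degenerate case, such as coinciding points, in which every slope may qualify; outside
    -- of it two distinct slopes are impossible.
    count-slopes : ∀ {R : Carrier → Set} (R? : ∀ s → Dec (R s)) (P? : Dec P) →
      (∀ {s t} → R s → R t → s ≢ t → P) → ∑ elements (λ s → ⟦ R? s ⟧) ≤ 1 + q * ⟦ P? ⟧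
    count-slopes R? (yes p) _    = ≤-trans (∑-≤ elements (λ s → ⟦⟧≤1 (R? s))) (n≤1+n _)
    count-slopes R? (no ¬p) R⇒P = ≤-trans
      (count-≤1 R? (Finite.unique finite) λ {s} {t} _ _ rs rt → amo s t rs rt) (m≤m+n 1 _)
      where
      amo : ∀ s t → _ → _ → s ≡ t
      amo s t rs rt with s ≟ t
      ... | yes s≡t = s≡t
      ... | no  s≢t = contradiction (R⇒P rs rt s≢t) ¬p

    ∑-diagonal : ∀ {f : Carrier → Plane → Plane → ℕ} →
      (∀ x y → ∑ elements (λ s → f s x y) ≤ 1 + q * ⟦ x plane.≟ y ⟧) →
      ∑ elements (λ s → ∑ E (λ x → ∑ E (f s x))) ≤ n * n + n * q
    ∑-diagonal {f} le = begin
      ∑ elements (λ s → ∑ E (λ x → ∑ E (f s x)))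
        ≡⟨ trans (∑-swap elements E _) (∑-cong E (λ x → ∑-swap elements E _)) ⟩
      ∑ E (λ x → ∑ E (λ y → ∑ elements (λ s → f s x y)))
        ≤⟨ ∑-≤ E row ⟩
      n * (n + q)
        ≡⟨ *-distribˡ-+ n n q ⟩
      n * n + n * q ∎
      where
      open ≤-Reasoning
      row : ∀ x → ∑ E (λ y → ∑ elements (λ s → f s x y)) ≤ n + q
      row x = begin
        ∑ E (λ y → ∑ elements (λ s → f s x y))   ≤⟨ ∑-mono E (le x) ⟩
        ∑ E (λ y → 1 + q * ⟦ x plane.≟ y ⟧)      ≡⟨ ∑-+ E _ _ ⟩
        ∑ E (λ _ → 1) + ∑ E (λ y → q * ⟦ x plane.≟ y ⟧)
          ≡⟨ cong₂ _+_ (trans (∑-const E 1) (*-identityʳ n)) (∑-*ˡ E q _) ⟩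
        n + q * ∑ E (λ y → ⟦ x plane.≟ y ⟧)      ≤⟨ +-monoʳ-≤ n (*-monoʳ-≤ q (diagonal x)) ⟩
        n + q * 1                                ≡⟨ cong (n +_) (*-identityʳ q) ⟩
        n + q                                    ∎

  zero? nonzero? : Plane → Plane → ℕ
  zero?    x y = ⟦ dist x y ≟ 0# ⟧
  nonzero? x y = ⟦ ¬? (dist x y ≟ 0#) ⟧

  -- Pairs at distance 0 are set apart: when E is a union of isotropic lines they are too
  -- numerous for the energy bound.
  isometric : Plane → Plane → Plane → Plane → ℕ
  isometric x y z t = nonzero? x y * nonzero? z t * ⟦ dist x y ≟ dist z t ⟧

  energy isosceles-count zero-count : ℕ
  energy          = ∑ E (λ x → ∑ E (λ y → ∑ E (λ z → ∑ E (λ t → isometric x y z t))))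
  isosceles-count = ∑ E (λ x → ∑ E (λ y → ∑ E (λ z → isometric x y x z)))
  zero-count      = ∑ E (λ x → ∑ E (λ y → zero? x y))

  private
    -- Sorted by first coordinate: on each of the q columns, distance 0 from x is a quadratic
    -- equation for the second coordinate.
    zero-row : ∀ x → ∑ E (λ y → zero? x y) ≤ q * 2
    zero-row x = ≤-trans (≤-reflexive (sym (∑-fibre E (zero? x) proj₁))) (∑-≤ elements column)
      where
      column : ∀ a → fibre E (zero? x) proj₁ a ≤ 2
      column a = ≤-trans
        (≤-reflexive (∑-cong E (λ y → sym (⟦⟧-× (dist x y ≟ 0#) (proj₁ y ≟ a)))))
        (count-≤2 (λ y → (dist x y ≟ 0#) ×-dec (proj₁ y ≟ a)) uniqueᴱ other)
        where
        other : ∀ {y} → dist x y ≡ 0# × proj₁ y ≡ a →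
                ∃[ y′ ] ∀ {z} → dist x z ≡ 0# × proj₁ z ≡ a → z ≡ y ⊎ z ≡ y′
        other {y₁ , y₂} (d≡0 , refl) = (y₁ , proj₂ x ⊕ proj₂ x ⊖ y₂) , on-column
          where
          on-column : ∀ {z} → dist x z ≡ 0# × proj₁ z ≡ y₁ →
                      z ≡ (y₁ , y₂) ⊎ z ≡ (y₁ , proj₂ x ⊕ proj₂ x ⊖ y₂)
          on-column {_ , z₂} (d′≡0 , refl) = [ inj₁ ∘ cong (y₁ ,_) , inj₂ ∘ cong (y₁ ,_) ]′
            (dist-zero-fibre {x} {y₁} {y₂} {z₂} d≡0 d′≡0)

  zero-count-≤ : zero-count ≤ n * (q * 2)
  zero-count-≤ = ∑-≤ E zero-row

  -- With ν x d the number of points at nonzero distance d from x, the energy is the sum of ν x d ν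
  -- z d over x, z and d, and the isosceles triangles are its terms with x = z. Applying 2ab ≤ a² +
  -- b² to each term is enough.
  energy-≤ : energy ≤ n * isosceles-count
  energy-≤ = *-cancelˡ-≤ 2 (begin
    2 * energy
      ≡⟨ cong (2 *_) (∑-cong E (λ x → ∑-swap E E _)) ⟩
    2 * ∑ E (λ x → ∑ E (λ z → ∑ E (λ y → ∑ E (λ t → isometric x y z t))))
      ≡⟨ cong (2 *_) (∑-cong E (λ x → ∑-cong E (λ z →
           ∑-fibre² E E (nonzero? x) (nonzero? z) (dist x) (dist z)))) ⟨
    2 * ∑ E (λ x → ∑ E (λ z → ∑ elements (λ d → ν x d * ν z d)))
      ≡⟨ trans (sym (∑-*ˡ E 2 _)) (∑-cong E (λ x → trans (sym (∑-*ˡ E 2 _))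
           (∑-cong E (λ z → sym (∑-*ˡ elements 2 _))))) ⟩
    ∑ E (λ x → ∑ E (λ z → ∑ elements (λ d → 2 * (ν x d * ν z d))))
      ≤⟨ ∑-mono E (λ x → ∑-mono E (λ z → ∑-mono elements (λ d → 2ab≤a²+b² (ν x d) (ν z d)))) ⟩
    ∑ E (λ x → ∑ E (λ z → ∑ elements (λ d → ν x d * ν x d + ν z d * ν z d)))
      ≡⟨ ∑-cong E (λ x → trans (∑-cong E (λ z → ∑-+ elements _ _)) (∑-+ E _ _)) ⟩
    ∑ E (λ x → ∑ E (λ _ → D x) + ∑ E D)
      ≡⟨ ∑-+ E _ _ ⟩
    ∑ E (λ x → ∑ E (λ _ → D x)) + ∑ E (λ _ → ∑ E D)
      ≡⟨ cong₂ _+_ (trans (∑-cong E (λ x → ∑-const E (D x))) (∑-*ˡ E n D)) (∑-const E (∑ E D)) ⟩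
    n * ∑ E D + n * ∑ E D
      ≡⟨ cong (λ T → n * T + n * T) (∑-cong E (λ x →
           ∑-fibre² E E (nonzero? x) (nonzero? x) (dist x) (dist x))) ⟩
    n * isosceles-count + n * isosceles-count
      ≡⟨ double (n * isosceles-count) ⟩
    2 * (n * isosceles-count) ∎)
    where
    open ≤-Reasoning
    ν : Plane → Carrier → ℕ
    ν x = fibre E (nonzero? x) (dist x)
    D : Plane → ℕ
    D x = ∑ elements (λ d → ν x d * ν x d)
    double : ∀ a → a + a ≡ 2 * a
    double = solve-∀

  -- w s c and i s c weigh the line {x ∣ 2 (along s x) ≡ c}: w counts the pairs of E
  -- that it bisects and i the points of E that it contains.
  mirrored : Carrier → Plane × Plane → ℕ
  mirrored s (y , z) = ⟦ Anisotropic? s ⟧ * ⟦ across s y ≟ across s z ⟧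

  w i : Carrier → Carrier → ℕ
  w s = fibre E² (mirrored s) (λ (y , z) → along s y ⊕ along s z)
  i s = fibre E (λ _ → 1) (λ x → along s x ⊕ along s x)

  incidences : ℕ
  incidences = ∑ elements (λ s → ∑ elements (λ c → w s c * i s c))

  isosceles-count-≤ : isosceles-count ≤ n * n * 2 + incidences
  isosceles-count-≤ = begin
    isosceles-count
      ≤⟨ ∑-mono E (λ x → ∑-mono E (λ y → ∑-mono E (λ z → pointwise x y z))) ⟩
    ∑ E (λ x → ∑ E (λ y → ∑ E (λ z → ⟦ y plane.≟ z ⟧ + ⟦ twin x y plane.≟ z ⟧ + J x y z)))
      ≡⟨ trans (∑-cong E (λ x → trans (∑-cong E (λ y → ∑-+ E _ _)) (∑-+ E _ _))) (∑-+ E _ _) ⟩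
    ∑ E (λ x → ∑ E (λ y → ∑ E (λ z → ⟦ y plane.≟ z ⟧ + ⟦ twin x y plane.≟ z ⟧))) +
    ∑ E (λ x → ∑ E (λ y → ∑ E (λ z → J x y z)))
      ≤⟨ +-mono-≤ (∑-≤ E (λ x → ∑-≤ E (λ y → row x y))) (≤-reflexive total) ⟩
    n * (n * 2) + incidences
      ≡⟨ cong (_+ incidences) (sym (*-assoc n n 2)) ⟩
    n * n * 2 + incidences ∎
    where
    open ≤-Reasoning
    -- The only possible third vertex z ≢ y when yz is vertical, the direction without a slope s.
    twin : Plane → Plane → Plane
    twin (_ , x₂) (y₁ , y₂) = y₁ , x₂ ⊕ x₂ ⊖ y₂
    J : Plane → Plane → Plane → ℕ
    J x y z = ∑ elements (λ s →
      mirrored s (y , z) * 1 * ⟦ along s y ⊕ along s z ≟ along s x ⊕ along s x ⟧)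
    row : ∀ x y → ∑ E (λ z → ⟦ y plane.≟ z ⟧ + ⟦ twin x y plane.≟ z ⟧) ≤ 2
    row x y = ≤-trans (≤-reflexive (∑-+ E _ _)) (+-mono-≤ (diagonal y) (diagonal (twin x y)))
    total : ∑ E (λ x → ∑ E (λ y → ∑ E (λ z → J x y z))) ≡ incidences
    total = sym (trans
      (∑-cong elements (λ s → trans (∑-fibre² E² E (mirrored s) (λ _ → 1) _ _)
        (trans (∑-E² _) (trans (∑-cong E (λ y → ∑-swap E E _)) (∑-swap E E _)))))
      (trans (∑-swap elements E _) (∑-cong E (λ x → trans (∑-swap elements E _)
        (∑-cong E (λ y → ∑-swap elements E _))))))
    pointwise : ∀ x y z → isometric x y x z ≤ ⟦ y plane.≟ z ⟧ + ⟦ twin x y plane.≟ z ⟧ + J x y z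
    pointwise x y z with dist x y ≟ 0# | dist x z ≟ 0# | dist x y ≟ dist x z
    ... | yes _ | _     | _     = z≤n
    ... | no  _ | yes _ | _     = z≤n
    ... | no  _ | no  _ | no  _ = z≤n
    ... | no d≢0 | no _ | yes eq with y plane.≟ z
    ...   | yes _   = s≤s z≤n
    ...   | no  y≢z with isosceles {x} {y} {z} eq d≢0 y≢z
    ...     | inj₁ (z₁≡ , z₂≡) = ≤-trans
              (≤-reflexive (sym (⟦⟧-true (sym (cong₂ _,_ z₁≡ z₂≡)) (twin x y plane.≟ z))))
              (m≤m+n _ _)
    ...     | inj₂ (s , anisotropic , across≡ , along≡) = ≤-trans (≤-trans
              (≤-reflexive (sym (cong₂ _*_ (cong (_* 1) (cong₂ _*_
                (⟦⟧-true anisotropic (Anisotropic? s)) (⟦⟧-true across≡ (across s y ≟ across s z))))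
                (⟦⟧-true along≡ (along s y ⊕ along s z ≟ along s x ⊕ along s x)))))
              (∑-≥ (λ s → mirrored s (y , z) * 1 * ⟦ along s y ⊕ along s z ≟ along s x ⊕ along s x ⟧)
                   (Finite.complete finite s)))
              (m≤n+m _ _)

  -- Distinct y and z have at most one slope; only the n pairs (y , y) can be counted for all of
  -- them.
  ∑w-≤ : ∑ elements (λ s → ∑ elements (w s)) ≤ n * n + n * q
  ∑w-≤ = ≤-trans
    (≤-reflexive (∑-cong elements (λ s → trans (∑-fibre E² (mirrored s) _) (∑-E² (mirrored s)))))
    (∑-diagonal λ y z → ≤-trans
      (∑-mono elements (λ s → *-monoˡ-≤ ⟦ across s y ≟ across s z ⟧ (⟦⟧≤1 (Anisotropic? s))))
      (≤-trans (≤-reflexive (∑-cong elements (λ s → *-identityˡ _)))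
               (count-slopes (λ s → across s y ≟ across s z) (y plane.≟ z) across-slope-unique)))

  ∑i : ∀ s → ∑ elements (i s) ≡ n
  ∑i s = trans (∑-fibre E (λ _ → 1) _) (trans (∑-const E 1) (*-identityʳ n))

  -- Distinct points share at most one line of the family, while a point lies on one line for each
  -- of the q slopes.
  ∑i²-≤ : ∑ elements (λ s → ∑ elements (λ c → i s c * i s c)) ≤ n * n + n * q
  ∑i²-≤ = ≤-trans
    (≤-reflexive (∑-cong elements (λ s → trans (∑-fibre² E E (λ _ → 1) (λ _ → 1) _ _)
      (∑-cong E (λ x → ∑-cong E (λ y → *-identityˡ _))))))
    (∑-diagonal λ x y → count-slopes (λ s → along s x ⊕ along s x ≟ along s y ⊕ along s y)
      (x plane.≟ y) along-slope-unique)

  private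
    anisotropic : Carrier → ℕ
    anisotropic s = ⟦ Anisotropic? s ⟧

    -- For anisotropic s, `frame s p ≡ coframe s p′` alone says that a glide reflection takes p to
    -- p′. Equality of `apex` makes its translation part zero, leaving a reflection. So `C` counts
    -- glide reflections and `Cᵏ` reflections, and heuristically `Cᵏ` is a q-th part of `C`.
    apex : Carrier → Plane × Plane → Carrier
    apex s (_ , y) = across s y

    C Cᵏ : (Plane × Plane → Plane) → (Plane × Plane → Plane) → Carrier → ℕ
    C  φ ψ s = coincidences  plane finite E² (apex s) φ ψ
    Cᵏ φ ψ s = coincidencesᵏ plane finite E² (apex s) φ ψ

    mirrors translates : ℕ
    mirrors    = ∑ elements (λ s → anisotropic s * C (frame s) (coframe s) s)
    translates = ∑ E² (λ p → ∑ E² (λ p′ → ⟦ difference p plane.≟ difference p′ ⟧))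

    bisector-energy : ℕ
    bisector-energy = ∑ elements (λ s → ∑ elements (λ c → w s c * w s c))

    slope-count : ℕ
    slope-count = ∑ elements anisotropic

    q≤slope-count+2 : q ≤ slope-count + 2
    q≤slope-count+2 = begin
      q                                        ≡⟨ trans (∑-const elements 1) (*-identityʳ q) ⟨
      ∑ elements (λ _ → 1)                     ≡⟨ ∑-cong elements (λ s → either (isotropic? s)) ⟨
      ∑ elements (λ s → anisotropic s + ⟦ isotropic? s ⟧)
        ≡⟨ ∑-+ elements _ _ ⟩
      slope-count + ∑ elements (λ s → ⟦ isotropic? s ⟧)
        ≤⟨ +-monoʳ-≤ slope-count (count-≤2 isotropic? (Finite.unique finite)
             λ {s} iso → ⊝ s , λ iso′ → isotropic-slopes iso iso′) ⟩
      slope-count + 2                                ∎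
      where
      open ≤-Reasoning
      isotropic? : ∀ s → Dec (1# ⊕ s ⊗ s ≡ 0#)
      isotropic? s = 1# ⊕ s ⊗ s ≟ 0#
      either : (p? : Dec P) → ⟦ ¬? p? ⟧ + ⟦ p? ⟧ ≡ 1
      either (yes _) = refl
      either (no  _) = refl

    bisector-energy-≤ : bisector-energy ≤ ∑ elements (λ s → anisotropic s * Cᵏ (frame s) (coframe s) s)
    bisector-energy-≤ = ∑-mono elements slope
      where
      open ≤-Reasoning
      slope : ∀ s → ∑ elements (λ c → w s c * w s c) ≤ anisotropic s * Cᵏ (frame s) (coframe s) s
      slope s = begin
        ∑ elements (λ c → w s c * w s c)
          ≡⟨ ∑-fibre² E² E² (mirrored s) (mirrored s) _ _ ⟩
        ∑ E² (λ p → ∑ E² (λ p′ → g p p′))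
          ≡⟨ trans (∑-E² _) (∑-cong E (λ y → ∑-cong E (λ z → ∑-E² _))) ⟩
        ∑ E (λ y → ∑ E (λ z → ∑ E (λ y′ → ∑ E (λ z′ → g (y , z) (y′ , z′)))))
          -- Two pairs with the same bisector are regrouped into the pair (y , y′) and its mirror
          -- image (z , z′).
          ≡⟨ ∑-cong E (λ y → ∑-swap E E _) ⟩
        ∑ E (λ y → ∑ E (λ y′ → ∑ E (λ z → ∑ E (λ z′ → g (y , z) (y′ , z′)))))
          ≤⟨ ∑-mono E (λ y → ∑-mono E (λ y′ → ∑-mono E (λ z → ∑-mono E (λ z′ →
               pointwise y z y′ z′)))) ⟩
        ∑ E (λ y → ∑ E (λ y′ → ∑ E (λ z → ∑ E (λ z′ → anisotropic s * h (y , y′) (z , z′)))))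
          ≡⟨ trans (∑-E² _) (∑-cong E (λ y → ∑-cong E (λ y′ → ∑-E² _))) ⟨
        ∑ E² (λ p → ∑ E² (λ p′ → anisotropic s * h p p′))
          ≡⟨ trans (∑-cong E² (λ p → ∑-*ˡ E² (anisotropic s) _)) (∑-*ˡ E² (anisotropic s) _) ⟩
        anisotropic s * Cᵏ (frame s) (coframe s) s ∎
        where
        g h : Plane × Plane → Plane × Plane → ℕ
        g (y , z) (y′ , z′) = mirrored s (y , z) * mirrored s (y′ , z′) *
                              ⟦ along s y ⊕ along s z ≟ along s y′ ⊕ along s z′ ⟧
        h p p′ = ⟦ frame s p plane.≟ coframe s p′ ⟧ * ⟦ apex s p ≟ apex s p′ ⟧
        pointwise : ∀ y z y′ z′ → g (y , z) (y′ , z′) ≤ anisotropic s * h (y , y′) (z , z′)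
        pointwise y z y′ z′ with Anisotropic? s | across s y ≟ across s z | across s y′ ≟ across s z′
          | along s y ⊕ along s z ≟ along s y′ ⊕ along s z′
        ... | no  _ | _     | _     | _     = z≤n
        ... | yes _ | no  _ | _     | _     = z≤n
        ... | yes _ | yes _ | no  _ | _     = z≤n
        ... | yes _ | yes _ | yes _ | no  _ = z≤n
        ... | yes _ | yes across≡ | yes across′≡ | yes along≡ = ≤-reflexive (sym (trans
              (+-identityʳ _) (cong (_* 1) (⟦⟧-true
                (reflection⇒frame≡coframe {s} {y} {z} {y′} {z′} across≡ across′≡ along≡)
                (frame s (y , y′) plane.≟ coframe s (z , z′))))))

    -- Matched pairs have equal distances and, unless both are degenerate, are matched for one slope
    -- only. Nonzero distances are counted by `energy`, zero ones by `zero-count` squared, and the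
    -- n² combinations of degenerate pairs by up to q slopes each. This is how N re-enters the bound
    -- for Q.
    mirrors-≤ : mirrors ≤ energy + zero-count * zero-count + q * (n * n)
    mirrors-≤ = begin
      mirrors
        ≤⟨ ∑-mono elements (λ s → ≤-trans (*-monoˡ-≤ _ (⟦⟧≤1 (Anisotropic? s))) (≤-reflexive (*-identityˡ _))) ⟩
      ∑ elements (λ s → C (frame s) (coframe s) s)
        ≡⟨ trans (∑-swap elements E² _) (∑-cong E² (λ p → ∑-swap elements E² _)) ⟩
      ∑ E² (λ p → ∑ E² (λ p′ → ∑ elements (λ s → ⟦ frame s p plane.≟ coframe s p′ ⟧)))
        ≤⟨ ∑-mono E² (λ p → ∑-mono E² (λ p′ → pointwise p p′)) ⟩
      ∑ E² (λ p → ∑ E² (λ p′ → iso p p′ + null p * null p′ + q * (same p * same p′)))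
        ≡⟨ trans (∑-cong E² (λ p → trans (∑-+ E² _ _) (cong₂ _+_ (∑-+ E² _ _) (∑-*ˡ E² q _))))
             (trans (∑-+ E² _ _) (cong₂ _+_ (∑-+ E² _ _) (∑-*ˡ E² q _))) ⟩
      ∑ E² (λ p → ∑ E² (iso p)) + ∑ E² (λ p → ∑ E² (λ p′ → null p * null p′)) +
        q * ∑ E² (λ p → ∑ E² (λ p′ → same p * same p′))
        ≡⟨ cong₂ (λ a b → a + b + q * ∑ E² (λ p → ∑ E² (λ p′ → same p * same p′)))
             (trans (∑-E² _) (∑-cong E (λ x → ∑-cong E (λ y → ∑-E² _))))
             (trans (sym (∑-*-∑ E² E² null null)) (cong₂ _*_ (∑-E² null) (∑-E² null))) ⟩
      energy + zero-count * zero-count + q * ∑ E² (λ p → ∑ E² (λ p′ → same p * same p′))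
        ≤⟨ +-monoʳ-≤ (energy + zero-count * zero-count) (*-monoʳ-≤ q (≤-trans
             (≤-reflexive (sym (∑-*-∑ E² E² same same))) (*-mono-≤ ∑same-≤ ∑same-≤))) ⟩
      energy + zero-count * zero-count + q * (n * n) ∎
      where
      open ≤-Reasoning
      iso : Plane × Plane → Plane × Plane → ℕ
      iso (x , y) (z , t) = isometric x y z t
      null same : Plane × Plane → ℕ
      null (x , y) = zero? x y
      same (x , y) = ⟦ x plane.≟ y ⟧
      ∑same-≤ : ∑ E² same ≤ n
      ∑same-≤ = ≤-trans (≤-reflexive (∑-E² same))
        (≤-trans (∑-≤ E diagonal) (≤-reflexive (*-identityʳ n)))
      pointwise : ∀ p p′ → ∑ elements (λ s → ⟦ frame s p plane.≟ coframe s p′ ⟧) ≤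
                           iso p p′ + null p * null p′ + q * (same p * same p′)
      pointwise p@(x , y) p′@(z , t) with dist x y ≟ dist z t
      ... | no  d≢d′ = ≤-trans (≤-reflexive (count-0 (λ s → frame s p plane.≟ coframe s p′) elements
              (λ {s} _ eq → d≢d′ (reflection-isometry {s} {x} {y} {z} {t} eq)))) z≤n
      ... | yes d≡d′ = ≤-trans
              (count-slopes (λ s → frame s p plane.≟ coframe s p′)
                ((x plane.≟ y) ×-dec (z plane.≟ t)) reflection-slope-unique)
              (+-mono-≤ dichotomy (*-monoʳ-≤ q (≤-reflexive (⟦⟧-× (x plane.≟ y) (z plane.≟ t)))))
        where
        dichotomy : 1 ≤ nonzero? x y * nonzero? z t * 1 + zero? x y * zero? z t
        dichotomy with dist x y ≟ 0# | dist z t ≟ 0#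
        ... | yes _   | yes _    = ≤-refl
        ... | no  _   | no  _    = ≤-refl
        ... | yes d≡0 | no  d′≢0 = contradiction (trans (sym d≡d′) d≡0) d′≢0
        ... | no  d≢0 | yes d′≡0 = contradiction (trans d≡d′ d′≡0) d≢0

    translates-≤ : translates ≤ n * (n * n)
    translates-≤ = begin
      translates
        ≤⟨ ∑²-≤ (λ p → ≤-trans (≤-reflexive (∑-E² _)) (∑-≤ E (row p))) ⟩
      n * (n * (n * 1))
        ≡⟨ cong (λ m → n * (n * m)) (*-identityʳ n) ⟩
      n * (n * n) ∎
      where
      open ≤-Reasoning
      row : ∀ p z → ∑ E (λ t → ⟦ difference p plane.≟ difference (z , t) ⟧) ≤ 1
      row p z = count-≤1 (λ t → difference p plane.≟ difference (z , t)) uniqueᴱ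
        (λ _ _ eq eq′ → difference-injective {z} (trans (sym eq) eq′))

    -- A pair p′ ≢ p counted here for the slope s is a translate of p along (1 , s), so p
    -- and p′ determine s.
    parallels-≤ : ∀ (φ : Carrier → Plane × Plane → Plane) →
      (∀ {s x y x′ y′} → φ s (x , y) ≡ φ s (x′ , y′) → frame s (x , y) ≡ frame s (x′ , y′)) →
      ∑ elements (λ s → anisotropic s * Cᵏ (φ s) (φ s) s) ≤ translates + q * (n * n)
    parallels-≤ φ φ⇒frame = begin
      ∑ elements (λ s → anisotropic s * Cᵏ (φ s) (φ s) s)
        ≡⟨ ∑-cong elements (λ s → trans (sym (∑-*ˡ E² (anisotropic s) _))
             (∑-cong E² (λ p → trans (sym (∑-*ˡ E² (anisotropic s) _)) (∑-cong E² (λ p′ → merge s p p′))))) ⟩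
      ∑ elements (λ s → ∑ E² (λ p → ∑ E² (λ p′ → ⟦ R? p p′ s ⟧)))
        ≡⟨ trans (∑-swap elements E² _) (∑-cong E² (λ p → ∑-swap elements E² _)) ⟩
      ∑ E² (λ p → ∑ E² (λ p′ → ∑ elements (λ s → ⟦ R? p p′ s ⟧)))
        ≤⟨ ∑-mono E² (λ p → ∑-mono E² (λ p′ → pointwise p p′)) ⟩
      ∑ E² (λ p → ∑ E² (λ p′ → ⟦ difference p plane.≟ difference p′ ⟧ + q * ⟦ p pairs.≟ p′ ⟧))
        ≡⟨ trans (∑-cong E² (λ p → trans (∑-+ E² _ _) (cong₂ _+_ refl (∑-*ˡ E² q _))))
             (trans (∑-+ E² _ _) (cong (translates +_) (∑-*ˡ E² q _))) ⟩
      translates + q * ∑ E² (λ p → ∑ E² (λ p′ → ⟦ p pairs.≟ p′ ⟧))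
        ≤⟨ +-monoʳ-≤ translates (*-monoʳ-≤ q (≤-trans (∑²-≤ (λ p → count-≤1 (p pairs.≟_) uniqueᴱ²
             (λ _ _ eq eq′ → trans (sym eq) eq′))) (≤-reflexive (cong (n *_) (*-identityʳ n))))) ⟩
      translates + q * (n * n) ∎
      where
      open ≤-Reasoning
      uniqueᴱ² : Unique E²
      uniqueᴱ² = Unique.cartesianProduct⁺ uniqueᴱ uniqueᴱ
      R : Plane × Plane → Plane × Plane → Carrier → Set
      R p p′ s = Anisotropic s × φ s p ≡ φ s p′ × apex s p ≡ apex s p′
      R? : ∀ p p′ s → Dec (R p p′ s)
      R? p p′ s = Anisotropic? s ×-dec (φ s p plane.≟ φ s p′) ×-dec (apex s p ≟ apex s p′)
      merge : ∀ s p p′ → anisotropic s * (⟦ φ s p plane.≟ φ s p′ ⟧ * ⟦ apex s p ≟ apex s p′ ⟧) ≡ ⟦ R? p p′ s ⟧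
      merge s p p′ = sym (trans (⟦⟧-× (Anisotropic? s) _) (cong (anisotropic s *_) (⟦⟧-× (φ s p plane.≟ φ s p′) _)))
      pointwise : ∀ p p′ → ∑ elements (λ s → ⟦ R? p p′ s ⟧) ≤
                           ⟦ difference p plane.≟ difference p′ ⟧ + q * ⟦ p pairs.≟ p′ ⟧
      pointwise p@(x , y) p′@(x′ , y′) with difference p plane.≟ difference p′
      ... | yes _ = count-slopes (R? p p′) (p pairs.≟ p′)
              λ (_ , f , k) (_ , f′ , k′) → frame-slope-unique (φ⇒frame f) k (φ⇒frame f′) k′
      ... | no δ≢δ′ = ≤-trans (≤-reflexive (count-0 (R? p p′) elements
              (λ _ (st , f , _) → δ≢δ′ (frame-injective {x = x} {y} {x′} {y′} st (φ⇒frame f))))) z≤n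

  -- The variance inequality summed over the anisotropic slopes. Equal differences give equal
  -- frames, so each slope contributes at least `translates` to both subtracted squares of means;
  -- these nearly cancel the q `translates` that come from each of F and G. The at most two
  -- isotropic slopes missing from the sum leave the final `2 * translates`.
  bisector-energy-bound :
    q * bisector-energy ≤ energy + zero-count * zero-count + q * (n * n) + q * (q * (n * n)) + 2 * translates
  bisector-energy-bound = *-cancelˡ-≤ 2 (+-cancelʳ-≤ (2 * (q * translates)) _ _ (begin
    2 * (q * bisector-energy) + 2 * (q * translates)
      ≤⟨ +-mono-≤ (*-monoʳ-≤ 2 (*-monoʳ-≤ q bisector-energy-≤))
                  (*-monoʳ-≤ 2 (*-monoˡ-≤ translates q≤slope-count+2)) ⟩
    2 * (q * S) + 2 * ((slope-count + 2) * translates)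
      ≡⟨ e₁ (q * S) slope-count translates ⟩
    2 * (q * S) + slope-count * (2 * translates) + 4 * translates
      ≤⟨ +-monoˡ-≤ (4 * translates) summed ⟩
    2 * mirrors + q * (F + G) + 4 * translates
      ≤⟨ +-monoˡ-≤ (4 * translates) (+-mono-≤ (*-monoʳ-≤ 2 mirrors-≤) (*-monoʳ-≤ q
           (+-mono-≤ (parallels-≤ frame id) (parallels-≤ coframe coframe⇒frame)))) ⟩
    2 * M + q * (translates + q * (n * n) + (translates + q * (n * n))) + 4 * translates
      ≡⟨ e₂ M q translates (n * n) ⟩
    2 * (M + q * (q * (n * n)) + 2 * translates) + 2 * (q * translates) ∎))
    where
    open ≤-Reasoning
    S F G M : ℕ
    S = ∑ elements (λ s → anisotropic s * Cᵏ (frame s) (coframe s) s)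
    F = ∑ elements (λ s → anisotropic s * Cᵏ (frame s) (frame s) s)
    G = ∑ elements (λ s → anisotropic s * Cᵏ (coframe s) (coframe s) s)
    M = energy + zero-count * zero-count + q * (n * n)
    e₁ : ∀ a s t → 2 * a + 2 * ((s + 2) * t) ≡ 2 * a + s * (2 * t) + 4 * t
    e₁ = solve-∀
    e₂ : ∀ M q t m → 2 * M + q * (t + q * m + (t + q * m)) + 4 * t ≡
                     2 * (M + q * (q * m) + 2 * t) + 2 * (q * t)
    e₂ = solve-∀
    slope : ∀ s → 2 * (q * Cᵏ (frame s) (coframe s) s) + 2 * translates ≤
                  2 * C (frame s) (coframe s) s +
                  q * (Cᵏ (frame s) (frame s) s + Cᵏ (coframe s) (coframe s) s)
    slope s = ≤-trans
      (+-monoʳ-≤ (2 * (q * Cᵏ (frame s) (coframe s) s)) (≤-trans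
        (≤-reflexive (cong (translates +_) (+-identityʳ translates)))
        (+-mono-≤
          (∑-mono E² λ p → ∑-mono E² λ p′ → ⟦⟧-mono frame-cong
            (difference p plane.≟ difference p′) (frame s p plane.≟ frame s p′))
          (∑-mono E² λ p → ∑-mono E² λ p′ → ⟦⟧-mono (frame⇒coframe ∘ frame-cong)
            (difference p plane.≟ difference p′) (coframe s p plane.≟ coframe s p′)))))
      (coincidences-variance plane finite E² (apex s) (frame s) (coframe s))
    summed : 2 * (q * S) + slope-count * (2 * translates) ≤ 2 * mirrors + q * (F + G)
    summed = subst₂ _≤_
      (trans (∑-cong elements (λ s → *-distribˡ-+ (anisotropic s) _ (2 * translates))) (trans (∑-+ elements _ _)
        (cong₂ _+_ (trans (∑-cong elements (λ s → pull₂ (anisotropic s) q _))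
                          (trans (∑-*ˡ elements 2 _) (cong (2 *_) (∑-*ˡ elements q _))))
                   (∑-*ʳ elements (2 * translates) anisotropic))))
      (trans (∑-cong elements (λ s → pull₃ (anisotropic s) q _ _ _)) (trans (∑-+ elements _ _)
        (cong₂ _+_ (∑-*ˡ elements 2 _)
                   (trans (∑-*ˡ elements q _) (cong (q *_) (∑-+ elements _ _))))))
      (∑-mono elements (λ s → *-monoʳ-≤ (anisotropic s) (slope s)))
      where
      pull₂ : ∀ u q a → u * (2 * (q * a)) ≡ 2 * (q * (u * a))
      pull₂ = solve-∀
      pull₃ : ∀ u q a b c → u * (2 * a + q * (b + c)) ≡ 2 * (u * a) + q * (u * b + u * c)
      pull₃ = solve-∀

  -- The sum over all lines of 2 w (q i - n) ≤ w² / λ + λ (q i - n)² for λ = κ n² / q³, with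
  -- denominators and subtractions cleared.
  incidence-bound : ∀ κ .{{_ : NonZero q}} →
    2 * (κ * (n * n) * (q * incidences)) ≤
    q * q * (q * bisector-energy) + 2 * (κ * (n * n * n) * (n * n + n * q)) + κ * κ * (n * n * n * n * n)
  incidence-bound κ = *-cancelˡ-≤ (q * q * q) {{m*n≢0 (q * q) q {{m*n≢0 q q}}}}
    -- The mean terms cancel exactly: b n = q d, hence q² d² + b² n² = 2 q d b n. Of the second
    -- moment of `i` only b² n q remains.
    (+-cancelʳ-≤ (q * (2 * (d * b * n))) _ _ (begin
    q * q * q * (2 * (κ * (n * n) * (q * incidences))) + q * (2 * (d * b * n))
      ≡⟨ cong (_+ q * (2 * (d * b * n))) (e₁ q κ n incidences) ⟩
    2 * (a * b * incidences) + q * (2 * (d * b * n))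
      ≤⟨ summed ⟩
    a * a * bisector-energy + 2 * (a * d * W) + q * (q * (d * d)) + b * b * I
      ≤⟨ +-mono-≤ (+-monoˡ-≤ (q * (q * (d * d))) (+-monoʳ-≤ (a * a * bisector-energy)
           (*-monoʳ-≤ 2 (*-monoʳ-≤ (a * d) ∑w-≤)))) (*-monoʳ-≤ (b * b) ∑i²-≤) ⟩
    a * a * bisector-energy + 2 * (a * d * (n * n + n * q)) + q * (q * (d * d)) + b * b * (n * n + n * q)
      ≡⟨ e₂ q κ n bisector-energy ⟩
    q * q * q * (q * q * (q * bisector-energy) + 2 * (κ * (n * n * n) * (n * n + n * q))
      + κ * κ * (n * n * n * n * n)) + q * (2 * (d * b * n)) ∎))
    where
    open ≤-Reasoning
    a b d W I : ℕ
    a = q * q * q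
    b = κ * (n * n) * q
    d = κ * (n * n * n)
    W = ∑ elements (λ s → ∑ elements (w s))
    I = ∑ elements (λ s → ∑ elements (λ c → i s c * i s c))
    e₁ : ∀ q κ n T → q * q * q * (2 * (κ * (n * n) * (q * T))) ≡ 2 * (q * q * q * (κ * (n * n) * q) * T)
    e₁ = solve-∀
    e₂ : ∀ q κ n Q →
      q * q * q * (q * q * q) * Q + 2 * (q * q * q * (κ * (n * n * n)) * (n * n + n * q))
        + q * (q * (κ * (n * n * n) * (κ * (n * n * n))))
        + κ * (n * n) * q * (κ * (n * n) * q) * (n * n + n * q) ≡
      q * q * q * (q * q * (q * Q) + 2 * (κ * (n * n * n) * (n * n + n * q)) + κ * κ * (n * n * n * n * n))
        + q * (2 * (κ * (n * n * n) * (κ * (n * n) * q) * n))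
    e₂ = solve-∀
    summed : 2 * (a * b * incidences) + q * (2 * (d * b * n)) ≤
             a * a * bisector-energy + 2 * (a * d * W) + q * (q * (d * d)) + b * b * I
    summed = subst₂ _≤_
      (trans (∑-+ elements _ _) (cong₂ _+_
        (trans (∑-*ˡ elements 2 _) (cong (2 *_) (∑-*ˡ elements (a * b) _)))
        (trans (∑-cong elements (λ s → cong (λ m → 2 * (d * b * m)) (∑i s))) (∑-const elements _))))
      (trans (∑-+ elements _ _) (cong₂ _+_
        (trans (∑-+ elements _ _) (cong₂ _+_
          (trans (∑-+ elements _ _) (cong₂ _+_
            (∑-*ˡ elements (a * a) _)
            (trans (∑-*ˡ elements 2 _) (cong (2 *_) (∑-*ˡ elements (a * d) _)))))
          (∑-const elements _)))
        (∑-*ˡ elements (b * b) _)))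
      (∑-mono elements (λ s → ∑-amgm elements (w s) (i s) a b d))

  energy-bound : ∀ κ .{{_ : NonZero n}} .{{_ : NonZero q}} .{{_ : NonZero κ}} →
    q * q * q * q ≤ κ * n * (κ * n) * (κ * n) →
    q * energy ≤ (6 * (κ * κ) + 9 * κ + 2) * (n * n * n * n)
  energy-bound κ q⁴≤ = energy-arithmetic n q κ q⁴≤ q≤κn energy-≤ isosceles-count-≤
    zero-count-≤ translates-≤ bisector-energy-bound (incidence-bound κ)
    where
    q≤κn : q ≤ κ * n
    q≤κn = ≮⇒≥ λ κn<q → <⇒≱
      (<-≤-trans (*-mono-< (*-mono-< κn<q κn<q) κn<q) (m≤m*n (q * q * q) q)) q⁴≤

-- Selecting the subset

∈-tuples⁺ : ∀ {xs v : List A} → All.All (_∈ xs) v → v ∈ tuples (length v) xs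
∈-tuples⁺ []          = here refl
∈-tuples⁺ (a∈ ∷ v⊆xs) = ∈-cartesianProductWith⁺ _∷_ a∈ (∈-tuples⁺ v⊆xs)

threshold : ∀ (f : ℕ → ℕ) {a} b → f 0 ≤ a → a < f b → ∃[ k ] f k ≤ a × a < f (suc k)
threshold f zero    lower upper = contradiction lower (<⇒≱ upper)
threshold f {a} (suc b) lower upper with <-≤-connex a (f b)
... | inj₁ a<fb = threshold f b lower a<fb
... | inj₂ fb≤a = b , fb≤a , upper

-- `energy-constant` is the factor produced by `energy-arithmetic`. In `sampling-constant` the
-- summand 8 κ serves the pairs at distance 0, through `8kq≤n`, and the other summand serves the
-- quadruples, through `few₄`.
energy-constant sampling-constant : ℕ → ℕ
energy-constant   κ = 6 * (κ * κ) + 9 * κ + 2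
sampling-constant κ = 8 * κ + 4 * energy-constant κ

module Selection (𝔽 : FiniteOddField) {E : List (PlaneGeometry.Plane 𝔽)} (uniqueᴱ : Unique E) where
  open FiniteOddField 𝔽 using (0#; finite)
  open PlaneGeometry 𝔽
  open Energy 𝔽 uniqueᴱ
  open Finite finite using (_≟_)

  private
    _≟ᴾ_ : DecidableEquality Plane
    _≟ᴾ_ = Product.≡-dec _≟_ _≟_

    open Sparsification {A = Plane} _≟ᴾ_

    -- Every pair at distance 0 is forbidden outright, so a coincidence of two zero distances is
    -- already excluded by its first pair. The factor `unique?` restricts the support to tuples of
    -- distinct points, as `removal-average` requires.
    conflict₄ conflict₂ : List Plane → ℕ
    conflict₄ v@(x ∷ y ∷ z ∷ t ∷ []) = ⟦ unique? _≟ᴾ_ v ⟧ * isometric x y z t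
    conflict₄ _                      = 0
    conflict₂ v@(x ∷ y ∷ [])         = ⟦ unique? _≟ᴾ_ v ⟧ * zero? x y
    conflict₂ _                      = 0

    bracket-support : ∀ {v : List Plane} (u? : Dec (Unique v)) c → ⟦ u? ⟧ * c ≢ 0 → Unique v
    bracket-support (yes u) _ _   = u
    bracket-support (no  _) _ 0≢0 = contradiction refl 0≢0

    support₄ : ∀ {v} → conflict₄ v ≢ 0 → Unique v
    support₄ {v@(x ∷ y ∷ z ∷ t ∷ [])} = bracket-support (unique? _≟ᴾ_ v) (isometric x y z t)
    support₄ {[]}                    0≢0 = contradiction refl 0≢0
    support₄ {_ ∷ []}                0≢0 = contradiction refl 0≢0
    support₄ {_ ∷ _ ∷ []}            0≢0 = contradiction refl 0≢0
    support₄ {_ ∷ _ ∷ _ ∷ []}        0≢0 = contradiction refl 0≢0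
    support₄ {_ ∷ _ ∷ _ ∷ _ ∷ _ ∷ _} 0≢0 = contradiction refl 0≢0

    support₂ : ∀ {v} → conflict₂ v ≢ 0 → Unique v
    support₂ {v@(x ∷ y ∷ [])}  = bracket-support (unique? _≟ᴾ_ v) (zero? x y)
    support₂ {[]}              0≢0 = contradiction refl 0≢0
    support₂ {_ ∷ []}          0≢0 = contradiction refl 0≢0
    support₂ {_ ∷ _ ∷ _ ∷ _}   0≢0 = contradiction refl 0≢0

    conflicts₄ conflicts₂ : List Plane → ℕ
    conflicts₄ xs = ∑ (tuples 4 xs) conflict₄
    conflicts₂ xs = ∑ (tuples 2 xs) conflict₂

    bracket-≤ : (p? : Dec P) (c : ℕ) → ⟦ p? ⟧ * c + 0 ≤ c
    bracket-≤ p? c = ≤-trans (≤-reflexive (+-identityʳ _))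
      (≤-trans (*-monoˡ-≤ c (⟦⟧≤1 p?)) (≤-reflexive (*-identityˡ c)))

    ∑-tuples : ∀ k f → ∑ (tuples (suc k) E) f ≡ ∑ E (λ x → ∑ (tuples k E) (λ v → f (x ∷ v)))
    ∑-tuples k f = ∑-cartesianProductWith _∷_ E (tuples k E) f

    conflicts₄-≤ : conflicts₄ E ≤ energy
    conflicts₄-≤ = ≤-trans
      (≤-reflexive (trans (∑-tuples 3 _) (∑-cong E (λ x → trans (∑-tuples 2 _)
        (∑-cong E (λ y → trans (∑-tuples 1 _) (∑-cong E (λ z → ∑-tuples 0 _))))))))
      (∑-mono E λ x → ∑-mono E λ y → ∑-mono E λ z → ∑-mono E λ t →
        bracket-≤ (unique? _≟ᴾ_ (x ∷ y ∷ z ∷ t ∷ [])) (isometric x y z t))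

    conflicts₂-≤ : conflicts₂ E ≤ zero-count
    conflicts₂-≤ = ≤-trans
      (≤-reflexive (trans (∑-tuples 1 _) (∑-cong E (λ x → ∑-tuples 0 _))))
      (∑-mono E λ x → ∑-mono E λ y → bracket-≤ (unique? _≟ᴾ_ (x ∷ y ∷ [])) (zero? x y))

  DistanceDistinct : List Plane → Set
  DistanceDistinct U = ∀ {x y z t} → x ∈ U → y ∈ U → z ∈ U → t ∈ U →
    Unique (x ∷ y ∷ z ∷ t ∷ []) → dist x y ≢ dist z t

  private
    conflict-free : ∀ {U} → conflicts₄ U + conflicts₂ U ≡ 0 → DistanceDistinct U
    conflict-free {U} none {x} {y} {z} {t} x∈ y∈ z∈ t∈ distinct@((x≢y ∷ _) ∷ _) eq
      with dist x y ≟ 0#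
    ... | yes d≡0 = contradiction (≤-trans (≤-reflexive (sym found))
            (≤-trans (∑-≥ conflict₂ (∈-tuples⁺ (x∈ ∷ y∈ ∷ [])))
                     (≤-reflexive (m+n≡0⇒n≡0 (conflicts₄ U) none)))) λ ()
      where
      found : conflict₂ (x ∷ y ∷ []) ≡ 1
      found = cong₂ _*_ (⟦⟧-true ((x≢y ∷ []) ∷ [] ∷ []) (unique? _≟ᴾ_ (x ∷ y ∷ [])))
                        (⟦⟧-true d≡0 (dist x y ≟ 0#))
    ... | no  d≢0 = contradiction (≤-trans (≤-reflexive (sym found))
            (≤-trans (∑-≥ conflict₄ (∈-tuples⁺ (x∈ ∷ y∈ ∷ z∈ ∷ t∈ ∷ [])))
                     (≤-reflexive (m+n≡0⇒m≡0 (conflicts₄ U) none)))) λ ()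
      where
      found : conflict₄ (x ∷ y ∷ z ∷ t ∷ []) ≡ 1
      found = cong₂ _*_ (⟦⟧-true distinct (unique? _≟ᴾ_ (x ∷ y ∷ z ∷ t ∷ [])))
        (cong₂ _*_ (cong₂ _*_ (⟦⟧-true d≢0 (¬? (dist x y ≟ 0#)))
                              (⟦⟧-true (λ d′≡0 → d≢0 (trans eq d′≡0)) (¬? (dist z t ≟ 0#))))
                   (⟦⟧-true eq (dist x y ≟ dist z t)))

  module _ (κ : ℕ) .{{_ : NonZero n}} .{{_ : NonZero q}} .{{_ : NonZero κ}}
           (q⁴≤ : q * q * q * q ≤ κ * n * (κ * n) * (κ * n)) where

    private
      K α : ℕ
      K = energy-constant κ
      α = sampling-constant κ

      instance
        α≢0 : NonZero α
        α≢0 = >-nonZero (<-≤-trans (>-nonZero⁻¹ κ) (≤-trans (m≤n*m κ 8) (m≤m+n (8 * κ) (4 * K))))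

      cube : ℕ → ℕ
      cube k = α * k * (α * k) * (α * k)

      cube-≥ : ∀ k → α * k ≤ cube k
      cube-≥ k with α * k
      ... | zero  = z≤n
      ... | suc m = ≤-trans (m≤m*n (suc m) (suc m)) (m≤m*n (suc m * suc m) (suc m))

    module _ {k : ℕ} (k³≤q : cube k ≤ q) where

      few₄ : 4 * (k * k * k * conflicts₄ E) ≤ n ^ 4
      few₄ = *-cancelˡ-≤ q (begin
        q * (4 * (k * k * k * conflicts₄ E))         ≤⟨ *-monoʳ-≤ q (*-monoʳ-≤ 4 (*-monoʳ-≤ (k * k * k) conflicts₄-≤)) ⟩
        q * (4 * (k * k * k * energy))               ≡⟨ e₁ q k energy ⟩
        4 * (k * k * k) * (q * energy)               ≤⟨ *-monoʳ-≤ (4 * (k * k * k)) (energy-bound κ q⁴≤) ⟩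
        4 * (k * k * k) * (K * (n * n * n * n))      ≡⟨ e₂ k K (n * n * n * n) ⟩
        4 * K * (k * k * k) * (n * n * n * n)        ≤⟨ *-monoˡ-≤ (n * n * n * n) (≤-trans 4Kk³≤ k³≤q) ⟩
        q * (n * n * n * n)                          ≡⟨ cong (q *_) (e₃ n) ⟩
        q * n ^ 4                                    ∎)
        where
        open ≤-Reasoning
        e₁ : ∀ q k N → q * (4 * (k * k * k * N)) ≡ 4 * (k * k * k) * (q * N)
        e₁ = solve-∀
        e₂ : ∀ k K m → 4 * (k * k * k) * (K * m) ≡ 4 * K * (k * k * k) * m
        e₂ = solve-∀
        e₃ : ∀ n → n * n * n * n ≡ n * (n * (n * (n * 1)))
        e₃ = solve-∀
        e₄ : ∀ α k → α * α * α * (k * k * k) ≡ α * k * (α * k) * (α * k)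
        e₄ = solve-∀
        4Kk³≤ : 4 * K * (k * k * k) ≤ cube k
        4Kk³≤ = begin
          4 * K * (k * k * k)            ≤⟨ *-monoˡ-≤ (k * k * k) (m≤n+m (4 * K) (8 * κ)) ⟩
          α * (k * k * k)                ≤⟨ *-monoˡ-≤ (k * k * k) (≤-trans (m≤m*n α α) (m≤m*n (α * α) α)) ⟩
          α * α * α * (k * k * k)        ≡⟨ e₄ α k ⟩
          cube k                         ∎

      -- In terms of roots, α k ≤ q^(1/3) and q^(4/3) ≤ κ n, so 8 κ k q ≤ α k q ≤ q^(4/3) ≤ κ n. The
      -- comparison is carried out on cubes.
      8kq≤n : 8 * k * q ≤ n
      8kq≤n = ≮⇒≥ λ n<8kq → <⇒≱ (*-mono-< (*-mono-< (scaled n<8kq) (scaled n<8kq)) (scaled n<8kq)) (begin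
        8 * κ * k * q * (8 * κ * k * q) * (8 * κ * k * q)
          ≤⟨ *-mono-≤ (*-mono-≤ αkq αkq) αkq ⟩
        α * k * q * (α * k * q) * (α * k * q)
          ≡⟨ e₁ (α * k) q ⟩
        cube k * (q * q * q)
          ≤⟨ *-monoˡ-≤ (q * q * q) k³≤q ⟩
        q * (q * q * q)
          ≡⟨ *-comm q (q * q * q) ⟩
        q * q * q * q
          ≤⟨ q⁴≤ ⟩
        κ * n * (κ * n) * (κ * n) ∎)
        where
        open ≤-Reasoning
        e₁ : ∀ a q → a * q * (a * q) * (a * q) ≡ a * a * a * (q * q * q)
        e₁ = solve-∀
        e₂ : ∀ κ k q → κ * (8 * k * q) ≡ 8 * κ * k * q
        e₂ = solve-∀
        scaled : n < 8 * k * q → κ * n < 8 * κ * k * q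
        scaled lt = subst (κ * n <_) (e₂ κ k q) (*-monoʳ-< κ lt)
        αkq : 8 * κ * k * q ≤ α * k * q
        αkq = *-monoˡ-≤ q (*-monoˡ-≤ k (m≤m+n (8 * κ) (4 * K)))

      few₂ : 4 * (k * conflicts₂ E) ≤ n * n
      few₂ = begin
        4 * (k * conflicts₂ E)   ≤⟨ *-monoʳ-≤ 4 (*-monoʳ-≤ k (≤-trans conflicts₂-≤ zero-count-≤)) ⟩
        4 * (k * (n * (q * 2)))  ≡⟨ e₁ k n q ⟩
        8 * k * q * n            ≤⟨ *-monoˡ-≤ n 8kq≤n ⟩
        n * n                    ∎
        where
        open ≤-Reasoning
        e₁ : ∀ k n q → 4 * (k * (n * (q * 2))) ≡ 8 * k * q * n
        e₁ = solve-∀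

      k≤n : k ≤ n
      k≤n = ≤-trans (≤-trans (m≤n*m k 8) (m≤m*n (8 * k) q)) 8kq≤n

    Selected : Set
    Selected = ∃[ U ] (∀ {x} → x ∈ U → x ∈ E) × Unique U × DistanceDistinct U ×
      q ≤ 4 * α * length U * (4 * α * length U) * (4 * α * length U) × length U * length U ≤ q

    private
      sampled : ∀ k .{{_ : NonZero k}} → cube k ≤ q → q < cube (suc k) → Selected
      sampled k lower upper =
        let U , U⊆E , uniqueᵁ , k≤2U , U≤k , none =
              independent-subset {conflicts₄} {conflicts₂}
                (removal-average 4 conflict₄ support₄) (removal-average 2 conflict₂ support₂)
                k uniqueᴱ (k≤n lower) (few₄ lower) (few₂ lower)
        in U , U⊆E , uniqueᵁ , conflict-free none , large k≤2U , small U≤k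
        where
        open ≤-Reasoning
        large : ∀ {u} → k ≤ 2 * u → q ≤ 4 * α * u * (4 * α * u) * (4 * α * u)
        large {u} k≤2u = ≤-trans (<⇒≤ upper) (*-mono-≤ (*-mono-≤ le le) le)
          where
          e₁ : ∀ k → k + k ≡ 2 * k
          e₁ = solve-∀
          e₂ : ∀ α u → α * (2 * (2 * u)) ≡ 4 * α * u
          e₂ = solve-∀
          -- One factor 2 pays for rounding, as k + 1 ≤ 2 k, and the other for the points deleted
          -- while clearing conflicts.
          le : α * suc k ≤ 4 * α * u
          le = begin
            α * suc k          ≤⟨ *-monoʳ-≤ α (+-monoˡ-≤ k (>-nonZero⁻¹ k)) ⟩
            α * (k + k)        ≡⟨ cong (α *_) (e₁ k) ⟩
            α * (2 * k)        ≤⟨ *-monoʳ-≤ α (*-monoʳ-≤ 2 k≤2u) ⟩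
            α * (2 * (2 * u))  ≡⟨ e₂ α u ⟩
            4 * α * u          ∎
        -- Only k ≤ q^(1/3) points are sampled, so the upper bound q^(1/2) holds with constant 1.
        small : ∀ {u} → u ≤ k → u * u ≤ q
        small {u} u≤k = begin
          u * u                        ≤⟨ *-mono-≤ u≤k u≤k ⟩
          k * k                        ≤⟨ m≤m*n (k * k) k ⟩
          k * k * k                    ≤⟨ *-mono-≤ (*-mono-≤ k≤αk k≤αk) k≤αk ⟩
          cube k                       ≤⟨ lower ⟩
          q                            ∎
          where
          k≤αk : k ≤ α * k
          k≤αk = m≤n*m k α

      -- For k = 0 the field has fewer than α³ elements, so a single point is already large enough.
      singleton : q < cube 1 → Selected
      singleton q<α³ = let x , x∈E = inhabitant (>-nonZero⁻¹ n) in
        x ∷ [] , (λ { (here refl) → x∈E }) , [] ∷ [] ,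
        (λ { (here refl) (here refl) _ _ ((x≢x ∷ _) ∷ _) → contradiction refl x≢x }) ,
        ≤-trans (<⇒≤ q<α³) (*-mono-≤ (*-mono-≤ le le) le) , >-nonZero⁻¹ q
        where
        inhabitant : ∀ {xs : List Plane} → 0 < length xs → ∃[ x ] x ∈ xs
        inhabitant {x ∷ _} _ = x , here refl
        le : α * 1 ≤ 4 * α * 1
        le = *-monoˡ-≤ 1 (m≤n*m α 4)

    select : Selected
    -- k is determined by α k ≤ q^(1/3) < α (k + 1); the search may stop at `suc q`, since its cube
    -- is at least α (q + 1).
    select = choose (threshold cube (suc q) cube0≤q (≤-trans (m≤n*m (suc q) α) (cube-≥ (suc q))))
      where
      cube0≤q : cube 0 ≤ q
      cube0≤q = ≤-trans (≤-reflexive (cong (λ m → m * m * m) (*-zeroʳ α))) z≤n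
      choose : (∃[ k ] cube k ≤ q × q < cube (suc k)) → Selected
      choose (zero  , _     , upper) = singleton upper
      choose (suc k , lower , upper) = sampled (suc k) lower upper

-- Passing to the field Fin q

odd-prime-power : ∀ {p} r → Prime p → p ≢ 2 → ∃[ m ] p ^ r ≡ suc (m * 2)
odd-prime-power zero    _  _   = 0 , refl
odd-prime-power {p} (suc r) pr p≢2 with p % 2 in p%2≡ | m%n<n p 2 | odd-prime-power r pr p≢2
... | 0 | _ | _ = [ (λ ()) , (λ 2≡p → contradiction (sym 2≡p) p≢2) ]′
                    (prime⇒irreducible pr (m%n≡0⇒n∣m p 2 p%2≡))
... | 1 | _ | m , pʳ≡ = p / 2 * m * 2 + p / 2 + m , trans
      (cong₂ _*_ (trans (m≡m%n+[m/n]*n p 2) (cong (_+ p / 2 * 2) p%2≡)) pʳ≡) (product (p / 2) m)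
  where
  product : ∀ a b → suc (a * 2) * suc (b * 2) ≡ suc ((a * b * 2 + a + b) * 2)
  product = solve-∀
... | suc (suc _) | s≤s (s≤s ()) | _

-- Counting needs decidable propositional equality, so F is carried over to Fin q.
module Enumerated {c ℓ₁ ℓ₂} (F : HeytingField c ℓ₁ ℓ₂) {q} (F↔q : HasOrder F q) where
  private
    module F = HeytingField F
    module R = CommutativeRing (HeytingCommutativeRing.commutativeRing F.heytingCommutativeRing)

  open Inverse F↔q using (to; from; to-cong; from-cong; strictlyInverseˡ; strictlyInverseʳ)
  open import Relation.Binary.Reasoning.Setoid R.setoid

  private
    infixl 6 _⊕_
    infixl 7 _⊗_
    _⊕_ _⊗_ : Fin q → Fin q → Fin q
    a ⊕ b = to (from a R.+ from b)
    a ⊗ b = to (from a R.* from b)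
    ⊝_ : Fin q → Fin q
    ⊝ a = to (R.- from a)
    𝟘 𝟙 : Fin q
    𝟘 = to R.0#
    𝟙 = to R.1#

    rawRing : RawRing 0ℓ 0ℓ
    rawRing = record { _≈_ = _≡_ ; _+_ = _⊕_ ; _*_ = _⊗_ ; -_ = ⊝_ ; 0# = 𝟘 ; 1# = 𝟙 }

    from-injective : ∀ {a b} → from a R.≈ from b → a ≡ b
    from-injective {a} {b} eq = trans (sym (strictlyInverseˡ a)) (trans (to-cong eq) (strictlyInverseˡ b))

    to-injective : ∀ {x y} → to x ≡ to y → x R.≈ y
    to-injective {x} {y} eq = R.trans (R.sym (strictlyInverseʳ x))
      (R.trans (from-cong eq) (strictlyInverseʳ y))

    from-monomorphism : IsRingMonomorphism rawRing R.rawRing from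
    from-monomorphism = record
      { isRingHomomorphism = record
        { isSemiringHomomorphism = record
          { isNearSemiringHomomorphism = record
            { +-isMonoidHomomorphism = record
              { isMagmaHomomorphism = record
                { isRelHomomorphism = record { cong = from-cong }
                ; homo = λ _ _ → strictlyInverseʳ _
                }
              ; ε-homo = strictlyInverseʳ _
              }
            ; *-homo = λ _ _ → strictlyInverseʳ _
            }
          ; 1#-homo = strictlyInverseʳ _
          }
        ; -‿homo = λ _ → strictlyInverseʳ _
        }
      ; injective = from-injective
      }

    isCommutativeRing : IsCommutativeRing _≡_ _⊕_ _⊗_ ⊝_ 𝟘 𝟙
    isCommutativeRing =
      Algebra.Morphism.RingMonomorphism.isCommutativeRing from-monomorphism R.isCommutativeRing

    ring : CommutativeRing 0ℓ 0ℓ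
    ring = record { isCommutativeRing = isCommutativeRing }
    module K = CommutativeRing ring

    -- In the zero ring 0 - 0 would be invertible, that is, apart from 0.
    1≉0 : ¬ R.1# R.≈ R.0#
    1≉0 1≈0 = F.#-irrefl R.refl (F.invertible⇒# {R.0#} {R.0#}
      (R.0# , R.trans (R.zeroˡ _) (R.sym 1≈0) , R.trans (R.zeroʳ _) (R.sym 1≈0)))

    -- Apartness in F comes without a decision procedure, so inverses are searched for among the
    -- finitely many elements. If there is none, a cannot be apart from zero, and tightness makes it
    -- zero.
    inverse : ∀ {a} → a ≢ 𝟘 → ∃[ b ] b ⊗ a ≡ 𝟙
    inverse {a} a≢0 with Fin.any? (λ b → b ⊗ a Fin.≟ 𝟙)
    ... | yes found = found
    ... | no  none  = contradiction a≡0 a≢0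
      where
      ¬a#0 : ¬ from a F.# R.0#
      ¬a#0 a#0 = let y , y*≈1 , _ = F.#⇒invertible a#0 in none (to y , to-cong (begin
        from (to y) R.* from a         ≈⟨ R.*-cong (strictlyInverseʳ y) (R.sym (R.trans
                                            (R.+-congˡ (Algebra.Properties.Group.ε⁻¹≈ε R.+-group))
                                            (R.+-identityʳ _))) ⟩
        y R.* (from a R.- R.0#)        ≈⟨ y*≈1 ⟩
        R.1#                           ∎))
      a≡0 : a ≡ 𝟘
      a≡0 = trans (sym (strictlyInverseˡ a)) (to-cong (proj₁ (F.tight (from a) R.0#) ¬a#0))

  module _ {m} (q-odd : q ≡ suc (m * 2)) where
    private
      open Algebra.Properties.CommutativeMonoid.Sum K.+-commutativeMonoid
        using (sum; sum-permute; sum-replicate; ∑-distrib-+)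
      open import Algebra.Properties.Monoid.Mult K.+-monoid renaming (_×_ to _·_)

      -- Translating by 1 permutes the field, so the sum S of all its elements
      -- satisfies S = S + q · 1.
      characteristic : q · 𝟙 ≡ 𝟘
      characteristic = identityʳ-unique S (q · 𝟙) (sym (trans (sum-permute id shift)
        (trans (∑-distrib-+ id (λ _ → 𝟙)) (cong (S ⊕_) (sum-replicate q)))))
        where
        open Algebra.Properties.Group K.+-group using (identityʳ-unique; //-rightDividesˡ; //-rightDividesʳ)
        S : Fin q
        S = sum id
        shift : Permutation q q
        shift = permutation (_⊕ 𝟙) (_⊕ ⊝ 𝟙) (//-rightDividesˡ 𝟙) (//-rightDividesʳ 𝟙)

      odd-multiple : 𝟙 ⊕ 𝟙 ≡ 𝟘 → ∀ m → suc (m * 2) · 𝟙 ≡ 𝟙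
      odd-multiple 2≡0 zero    = K.+-identityʳ 𝟙
      odd-multiple 2≡0 (suc m) = trans (cong (λ a → 𝟙 ⊕ (𝟙 ⊕ a)) (odd-multiple 2≡0 m))
        (trans (cong (𝟙 ⊕_) 2≡0) (K.+-identityʳ 𝟙))

      2≢0 : 𝟙 ⊕ 𝟙 ≢ 𝟘
      2≢0 2≡0 = 1≉0 (to-injective (trans (sym (odd-multiple 2≡0 m))
        (trans (cong (_· 𝟙) (sym q-odd)) characteristic)))

    finiteOddField : FiniteOddField
    finiteOddField = record
      { isCommutativeRing = isCommutativeRing
      ; finite            = record
        { _≟_      = Fin._≟_
        ; elements = allFin q
        ; unique   = Unique.allFin⁺ q
        ; complete = ∈-allFin
        }
      ; inverse           = inverse
      ; 1+1≢0             = 2≢0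
      }

    open PlaneGeometry finiteOddField using (dist)

    encode : Point F → Fin q × Fin q
    encode (x₁ , x₂) = to x₁ , to x₂

    decode : Fin q × Fin q → Point F
    decode (a₁ , a₂) = from a₁ , from a₂

    private
      _≈ᴾ_ = Setoid._≈_ (planeSetoid F)

    encode-injective : ∀ {x y} → encode x ≡ encode y → x ≈ᴾ y
    encode-injective eq = to-injective (cong proj₁ eq) , to-injective (cong proj₂ eq)

    encode-cong : ∀ {x y} → x ≈ᴾ y → encode x ≡ encode y
    encode-cong (eq₁ , eq₂) = cong₂ _,_ (to-cong eq₁) (to-cong eq₂)

    decode-injective : ∀ {a b} → decode a ≈ᴾ decode b → a ≡ b
    decode-injective (eq₁ , eq₂) = cong₂ _,_ (from-injective eq₁) (from-injective eq₂)

    encode-decode : ∀ a → encode (decode a) ≡ a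
    encode-decode (a₁ , a₂) = cong₂ _,_ (strictlyInverseˡ a₁) (strictlyInverseˡ a₂)

    dist-encode : ∀ x y → dist (encode x) (encode y) ≡ to (‖_‖ F (_-ᵖ_ F x y))
    dist-encode (x₁ , x₂) (y₁ , y₂) = to-cong (R.+-cong (square x₁ y₁) (square x₂ y₂))
      where
      minus : ∀ x y → from (to x ⊕ ⊝ to y) R.≈ x R.- y
      minus x y = R.trans (strictlyInverseʳ _) (R.+-cong (strictlyInverseʳ x)
        (R.trans (strictlyInverseʳ _) (R.-‿cong (strictlyInverseʳ y))))
      square : ∀ x y → from ((to x ⊕ ⊝ to y) ⊗ (to x ⊕ ⊝ to y)) R.≈ (x R.- y) R.* (x R.- y)
      square x y = R.trans (strictlyInverseʳ _) (R.*-cong (minus x y) (minus x y))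

    module _ (E : PointSet F) where
      private
        open PointSet E
        E′ : List (Fin q × Fin q)
        E′ = map encode points
        uniqueᴱ′ : Unique E′
        uniqueᴱ′ = UniqueSetoid.map⁺ (planeSetoid F) (≡.setoid _) encode-injective unique
        open Selection finiteOddField uniqueᴱ′

      distinct-distance-subset : ∀ C → 0 < C → q ^[ 4 / 3 ]≪⟨ C ⟩ ∣ E ∣ →
        ∃[ U ] U ⊆ E × DistinctDistance F U ×
               q ^[ 1 / 3 ]≪⟨ 4 * sampling-constant C ⟩ ∣ U ∣ × ∣ U ∣ ≪⟨ 1 ⟩ q ^[ 1 / 2 ]
      distinct-distance-subset C 0<C E-large =
        let U′ , U′⊆E′ , uniqueᵁ′ , distinct , large , small =
              select C {{n≢0}} {{order≢0}} {{>-nonZero 0<C}} order⁴≤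
            U : PointSet F
            U = record
              { points = map decode U′
              ; unique = UniqueSetoid.map⁺ (≡.setoid _) (planeSetoid F) decode-injective uniqueᵁ′
              }
            encode-∈ : ∀ {x} → x ∈ᴾ map decode U′ → encode x ∈ U′
            encode-∈ x∈ = let u , u∈ , x≈u = ∈-map⁻ (≡.setoid _) (planeSetoid F) x∈ in
              subst (_∈ U′) (trans (sym (encode-decode u)) (sym (encode-cong x≈u))) u∈
        in U
         , (λ {x} x∈ →
              let e , e∈ , eq = ∈-map⁻ (planeSetoid F) (≡.setoid _) (U′⊆E′ (encode-∈ x∈)) in
              ∈-resp-≈ (planeSetoid F) (Setoid.sym (planeSetoid F) (encode-injective eq)) e∈)
         , (λ {x} {y} {z} {t} x∈ y∈ z∈ t∈ xyzt eq →
              distinct (encode-∈ x∈) (encode-∈ y∈) (encode-∈ z∈) (encode-∈ t∈)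
                (UniqueSetoid.map⁺ (planeSetoid F) (≡.setoid _) encode-injective xyzt)
                (trans (dist-encode x y) (trans (to-cong eq) (sym (dist-encode z t)))))
         , subst₂ _≤_ (trans order≡q (sym (*-identityʳ q)))
             (trans (cubed (4 * sampling-constant C * length U′)) (cong (λ u → (4 * sampling-constant C * u) ^ 3) (sym (length-map decode U′))))
             large
         , subst₂ _≤_ (trans (squared (length U′)) (cong (_^ 2) (sym (length-map decode U′))))
             (trans order≡q (trans (sym (*-identityʳ q)) (sym (*-identityˡ (q ^ 1))))) small
        where
        open Membership using (∈-map⁻; ∈-resp-≈)
        open import Data.List.Membership.Setoid (planeSetoid F) using () renaming (_∈_ to _∈ᴾ_)
        order : ℕ
        order = length (allFin q)
        order≡q : order ≡ q
        order≡q = length-tabulate id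
        order≢0 : NonZero order
        order≢0 = subst NonZero (sym (trans order≡q q-odd)) _
        squared : ∀ a → a * a ≡ a * (a * 1)
        squared = solve-∀
        cubed : ∀ a → a * a * a ≡ a * (a * (a * 1))
        cubed = solve-∀
        fourth : ∀ a → a * (a * (a * (a * 1))) ≡ a * a * a * a
        fourth = solve-∀
        order⁴≤ : order * order * order * order ≤
                  C * length E′ * (C * length E′) * (C * length E′)
        order⁴≤ = subst₂ _≤_
          (trans (fourth q) (cong (λ m → m * m * m * m) (sym order≡q)))
          (trans (sym (cubed (C * ∣ E ∣)))
                 (cong (λ m → C * m * (C * m) * (C * m)) (sym (length-map encode points)))) E-large
        n≢0 : NonZero (length E′)
        n≢0 = m*n≢0⇒n≢0 C {{m*n≢0⇒n≢0 (C * length E′ * (C * length E′)) {{>-nonZero (≤-trans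
          (>-nonZero⁻¹ _ {{m*n≢0 _ _ {{m*n≢0 _ _ {{m*n≢0 _ _ {{order≢0}} {{order≢0}}}} {{order≢0}}}} {{order≢0}}}})
          order⁴≤)}}}}

-- The constants depend on `C` alone. Odd characteristic is essential: in characteristic 2 the
-- distance of x and y depends only on σ(x) - σ(y), where σ adds the coordinates. Let E be the union
-- of the lines σ = c for c in an additive subgroup of order about q^(1/3). On a distinct distance
-- subset σ takes O(q^(1/6)) values, at most one of them repeatedly and none four times, so the
-- subset has only O(q^(1/6)) points.
theorem1p7 : ∀ {c ℓ₁ ℓ₂ : Level} (C : ℕ) → 0 < C →
    ∃[ A ] ∃[ B ] 0 < A × 0 < B ×
    (∀ (p r q : ℕ) → Prime p → p ≢ 2 → 0 < r → q ≡ p ^ r →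
    (F : HeytingField c ℓ₁ ℓ₂) → HasOrder F q →
    (E : PointSet F) → q ^[ 4 / 3 ]≪⟨ C ⟩ ∣ E ∣ →
    ∃[ U ] U ⊆ E × DistinctDistance F U ×
    q ^[ 1 / 3 ]≪⟨ A ⟩ ∣ U ∣ × ∣ U ∣ ≪⟨ B ⟩ q ^[ 1 / 2 ])
theorem1p7 C 0<C = 4 * sampling-constant C , 1 , 0<A , s≤s z≤n ,
  λ p r q prime p≢2 _ q≡pʳ F F↔q E E-large →
    let m , pʳ≡ = odd-prime-power r prime p≢2 in
    Enumerated.distinct-distance-subset F F↔q {m} (trans q≡pʳ pʳ≡) E C 0<C E-large
  where
  0<A : 0 < 4 * sampling-constant C
  0<A = ≤-trans 0<C (≤-trans (m≤n*m C 8)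
    (≤-trans (m≤m+n (8 * C) (4 * energy-constant C)) (m≤n*m (sampling-constant C) 4)))
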